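{- Let $X\subseteq\mathbb{Z}^2\setminus\{O\}$ be an arbitrary step set. (i) If $X$ is empty, then $\mathcal{A}_X$ is a trivial group. (ii) If $X$ is non-empty, and is contained in a line $\mathscr{L}$ through the origin, then $\mathcal{A}_X$ is a group if and only if $X$ contains points from $\mathscr{L}$ on both sides of the origin; in this case, $\mathcal{A}_X$ is isomorphic to $(\mathbb{Z},+)$. (iii) If $X$ is not contained in any line through the origin, then $\mathcal{A}_X$ is a group if and only if $X$ does not satisfy the Weak Line Condition (WLC); in this case, $\mathcal{A}_X$ is isomorphic to $(\mathbb{Z}^2,+)$.
   Context: Write $O=(0,0)$ for the origin. A step set is any (finite or infinite) subset $X$ of $\mathbb{Z}^2\setminus\{O\}$. $\mathcal{A}_X$ is the additive submonoid of $\mathbb{Z}^2$ generated by $X$ (with identity $O$). $X$ satisfies the WLC if it is contained in the closure of a half-plane determined by a line through the origin, i.e. in a closed half-plane of $\mathbb{R}^2$ whose bounding line passes through $O$. -}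

module Defs where

open import Algebra.Bundles using (Group; Monoid; AbelianGroup)
open import Algebra.Construct.DirectProduct using () renaming (abelianGroup to _×ᵃᵇ_)
open import Algebra.Core using (Op₁)
open import Algebra.Morphism.Structures using (module GroupMorphisms)
open import Algebra.Structures using (IsGroup)
open import Data.Integer.Base using (ℤ)
open import Data.Integer.Properties using (+-0-abelianGroup)
open import Data.Nat.Base as ℕ using (ℕ)
import Data.Nat.Properties as ℕ
open import Data.Product.Base using (Σ; ∃; ∃-syntax; _×_; _,_; proj₁; proj₂)
open import Data.Rational.Base as ℚ using (ℚ; 0ℚ; 1ℚ; ½; ∣_∣)
import Data.Rational.Properties as ℚ
open import Data.Rational.Solver using (module +-*-Solver)
open import Data.Sum.Base using (_⊎_)
open import Level using (Level; 0ℓ; _⊔_)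
open import Relation.Binary.PropositionalEquality using (_≡_; refl; sym; cong; cong₂; subst₂; module ≡-Reasoning)
open import Relation.Nullary.Negation.Core using (¬_)
open import Relation.Unary using (Pred; _∈_; _⊆_; _⊢_)

-- Reals are Cauchy sequences of rationals, compared by _≈ᴿ_ rather than _≡_.

Cauchy : (ℕ → ℚ) → Set
Cauchy u = ∀ ε → 0ℚ ℚ.< ε →
  ∃[ N ] (∀ m n → N ℕ.≤ m → N ℕ.≤ n → ∣ u m ℚ.- u n ∣ ℚ.< ε)

record ℝ : Set where
  field
    seq      : ℕ → ℚ
    isCauchy : Cauchy seq

open ℝ public

Eventually : (ℕ → Set) → Set
Eventually P = ∃[ N ] (∀ n → N ℕ.≤ n → P n)

infix 4 _≈ᴿ_ _≤ᴿ_ _<ᴿ_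

_≈ᴿ_ _≤ᴿ_ _<ᴿ_ : ℝ → ℝ → Set
x ≈ᴿ y = ∀ ε → 0ℚ ℚ.< ε → Eventually λ n → ∣ seq x n ℚ.- seq y n ∣ ℚ.< ε
x ≤ᴿ y = ∀ ε → 0ℚ ℚ.< ε → Eventually λ n → seq x n ℚ.< seq y n ℚ.+ ε
x <ᴿ y = ∃[ ε ] (0ℚ ℚ.< ε × Eventually λ n → seq x n ℚ.+ ε ℚ.< seq y n)

private
  half-pos : ∀ ε → 0ℚ ℚ.< ε → 0ℚ ℚ.< ε ℚ.* ½
  half-pos ε 0<ε =
    ℚ.positive⁻¹ _ {{ℚ.pos*pos⇒pos ε {{ℚ.positive 0<ε}} ½}}

  half+half : ∀ ε → ε ℚ.* ½ ℚ.+ ε ℚ.* ½ ≡ ε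
  half+half ε = begin
    ε ℚ.* ½ ℚ.+ ε ℚ.* ½  ≡⟨ ℚ.*-distribˡ-+ ε ½ ½ ⟨
    ε ℚ.* (½ ℚ.+ ½)      ≡⟨⟩
    ε ℚ.* 1ℚ             ≡⟨ ℚ.*-identityʳ ε ⟩
    ε                    ∎
    where open ≡-Reasoning

  join : ∀ {N₁ N₂} {k} → N₁ ℕ.⊔ N₂ ℕ.≤ k → N₁ ℕ.≤ k × N₂ ℕ.≤ k
  join {N₁} {N₂} p = ℕ.m⊔n≤o⇒m≤o N₁ N₂ p , ℕ.m⊔n≤o⇒n≤o N₁ N₂ p

  const-cauchy : ∀ q → Cauchy (λ _ → q)
  const-cauchy q ε 0<ε =
    0 , λ _ _ _ _ → subst₂ ℚ._<_ (sym (cong ∣_∣ (ℚ.+-inverseʳ q))) refl 0<ε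

  +-cauchy : ∀ u v → Cauchy u → Cauchy v → Cauchy (λ n → u n ℚ.+ v n)
  +-cauchy u v cu cv ε 0<ε with cu _ (half-pos ε 0<ε) | cv _ (half-pos ε 0<ε)
  ... | N₁ , h₁ | N₂ , h₂ = N₁ ℕ.⊔ N₂ , λ m n p q →
    let p₁ , p₂ = join p
        q₁ , q₂ = join q
    in begin-strict
      ∣ (u m ℚ.+ v m) ℚ.- (u n ℚ.+ v n) ∣      ≡⟨ cong ∣_∣ (rearrange (u m) (v m) (u n) (v n)) ⟩
      ∣ (u m ℚ.- u n) ℚ.+ (v m ℚ.- v n) ∣      ≤⟨ ℚ.∣p+q∣≤∣p∣+∣q∣ (u m ℚ.- u n) (v m ℚ.- v n) ⟩
      ∣ u m ℚ.- u n ∣ ℚ.+ ∣ v m ℚ.- v n ∣      <⟨ ℚ.+-mono-< (h₁ m n p₁ q₁) (h₂ m n p₂ q₂) ⟩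
      ε ℚ.* ½ ℚ.+ ε ℚ.* ½                      ≡⟨ half+half ε ⟩
      ε                                        ∎
    where
    open ℚ.≤-Reasoning
    rearrange : ∀ a b c d → (a ℚ.+ b) ℚ.- (c ℚ.+ d) ≡ (a ℚ.- c) ℚ.+ (b ℚ.- d)
    rearrange = solve 4 (λ a b c d → (a :+ b) :- (c :+ d) := (a :- c) :+ (b :- d)) refl
      where open +-*-Solver

  neg-cauchy : ∀ u → Cauchy u → Cauchy (λ n → ℚ.- u n)
  neg-cauchy u cu ε 0<ε with cu ε 0<ε
  ... | N , h = N , λ m n p q → begin-strict
      ∣ ℚ.- u m ℚ.- ℚ.- u n ∣  ≡⟨ cong ∣_∣ (rearrange (u m) (u n)) ⟩
      ∣ ℚ.- (u m ℚ.- u n) ∣    ≡⟨ ℚ.∣-p∣≡∣p∣ (u m ℚ.- u n) ⟩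
      ∣ u m ℚ.- u n ∣          <⟨ h m n p q ⟩
      ε                        ∎
    where
    open ℚ.≤-Reasoning
    rearrange : ∀ a b → ℚ.- a ℚ.- ℚ.- b ≡ ℚ.- (a ℚ.- b)
    rearrange = solve 2 (λ a b → :- a :- :- b := :- (a :- b)) refl
      where open +-*-Solver

  bounded : ∀ u → Cauchy u → ∃[ B ] (0ℚ ℚ.< B × Eventually λ n → ∣ u n ∣ ℚ.≤ B)
  bounded u cu with cu 1ℚ (ℚ.positive⁻¹ 1ℚ)
  ... | N , h = 1ℚ ℚ.+ ∣ u N ∣
              , ℚ.+-mono-<-≤ (ℚ.positive⁻¹ 1ℚ) (ℚ.0≤∣p∣ (u N))
              , N , λ n p → begin
      ∣ u n ∣                       ≡⟨ cong ∣_∣ (rearrange (u n) (u N)) ⟩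
      ∣ (u n ℚ.- u N) ℚ.+ u N ∣     ≤⟨ ℚ.∣p+q∣≤∣p∣+∣q∣ (u n ℚ.- u N) (u N) ⟩
      ∣ u n ℚ.- u N ∣ ℚ.+ ∣ u N ∣   ≤⟨ ℚ.+-monoˡ-≤ ∣ u N ∣ (ℚ.<⇒≤ (h n N p ℕ.≤-refl)) ⟩
      1ℚ ℚ.+ ∣ u N ∣                ∎
    where
    open ℚ.≤-Reasoning
    rearrange : ∀ a b → a ≡ (a ℚ.- b) ℚ.+ b
    rearrange = solve 2 (λ a b → a := (a :- b) :+ b) refl
      where open +-*-Solver

  scaled : ∀ B → 0ℚ ℚ.< B → ∀ ε → 0ℚ ℚ.< ε → ∃[ δ ] (0ℚ ℚ.< δ × B ℚ.* δ ≡ ε)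
  scaled B 0<B ε 0<ε = 1/B ℚ.* ε , 0<δ , (begin
      B ℚ.* (1/B ℚ.* ε)   ≡⟨ ℚ.*-assoc B 1/B ε ⟨
      (B ℚ.* 1/B) ℚ.* ε   ≡⟨ cong (ℚ._* ε) (ℚ.*-inverseʳ B) ⟩
      1ℚ ℚ.* ε            ≡⟨ ℚ.*-identityˡ ε ⟩
      ε                   ∎)
    where
    open ≡-Reasoning
    instance
      B-pos : ℚ.Positive B
      B-pos = ℚ.positive 0<B
      B≢0 : ℚ.NonZero B
      B≢0 = ℚ.pos⇒nonZero B
    1/B = ℚ.1/ B
    0<δ : 0ℚ ℚ.< 1/B ℚ.* ε
    0<δ = ℚ.positive⁻¹ _ {{ℚ.pos*pos⇒pos 1/B {{ℚ.1/pos⇒pos B}} ε {{ℚ.positive 0<ε}}}}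

  mul-bound : ∀ a b {B δ} → ∣ a ∣ ℚ.≤ B → 0ℚ ℚ.< B → ∣ b ∣ ℚ.< δ → ∣ a ℚ.* b ∣ ℚ.< B ℚ.* δ
  mul-bound a b {B} {δ} a≤B 0<B b<δ = begin-strict
      ∣ a ℚ.* b ∣      ≡⟨ ℚ.∣p*q∣≡∣p∣*∣q∣ a b ⟩
      ∣ a ∣ ℚ.* ∣ b ∣  ≤⟨ ℚ.*-monoʳ-≤-nonNeg ∣ b ∣ {{ℚ.∣-∣-nonNeg b}} a≤B ⟩
      B ℚ.* ∣ b ∣      <⟨ ℚ.*-monoʳ-<-pos B {{ℚ.positive 0<B}} b<δ ⟩
      B ℚ.* δ          ∎
    where open ℚ.≤-Reasoning

  *-cauchy : ∀ u v → Cauchy u → Cauchy v → Cauchy (λ n → u n ℚ.* v n)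
  *-cauchy u v cu cv ε 0<ε =
    let A , 0<A , N₁ , hA = bounded u cu
        B , 0<B , N₂ , hB = bounded v cv
        α , 0<α , Aα≡ε/2  = scaled A 0<A (ε ℚ.* ½) (half-pos ε 0<ε)
        β , 0<β , Bβ≡ε/2  = scaled B 0<B (ε ℚ.* ½) (half-pos ε 0<ε)
        N₃ , hv = cv α 0<α
        N₄ , hu = cu β 0<β
    in (N₁ ℕ.⊔ N₂) ℕ.⊔ (N₃ ℕ.⊔ N₄) , λ m n p q →
    let p₁₂ , p₃₄ = join {N₁ ℕ.⊔ N₂} p
        q₁₂ , q₃₄ = join {N₁ ℕ.⊔ N₂} q
        p₁ , _  = join {N₁} {N₂} p₁₂
        _  , q₂ = join {N₁} {N₂} q₁₂
        p₃ , p₄ = join p₃₄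
        q₃ , q₄ = join q₃₄
    in begin-strict
      ∣ u m ℚ.* v m ℚ.- u n ℚ.* v n ∣
        ≡⟨ cong ∣_∣ (rearrange (u m) (v m) (u n) (v n)) ⟩
      ∣ u m ℚ.* (v m ℚ.- v n) ℚ.+ v n ℚ.* (u m ℚ.- u n) ∣
        ≤⟨ ℚ.∣p+q∣≤∣p∣+∣q∣ (u m ℚ.* (v m ℚ.- v n)) (v n ℚ.* (u m ℚ.- u n)) ⟩
      ∣ u m ℚ.* (v m ℚ.- v n) ∣ ℚ.+ ∣ v n ℚ.* (u m ℚ.- u n) ∣
        <⟨ ℚ.+-mono-< (mul-bound (u m) (v m ℚ.- v n) (hA m p₁) 0<A (hv m n p₃ q₃))
                      (mul-bound (v n) (u m ℚ.- u n) (hB n q₂) 0<B (hu m n p₄ q₄)) ⟩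
      A ℚ.* α ℚ.+ B ℚ.* β
        ≡⟨ cong₂ ℚ._+_ Aα≡ε/2 Bβ≡ε/2 ⟩
      ε ℚ.* ½ ℚ.+ ε ℚ.* ½
        ≡⟨ half+half ε ⟩
      ε ∎
    where
    open ℚ.≤-Reasoning
    rearrange : ∀ a b c d → a ℚ.* b ℚ.- c ℚ.* d ≡ a ℚ.* (b ℚ.- d) ℚ.+ d ℚ.* (a ℚ.- c)
    rearrange = solve 4 (λ a b c d → a :* b :- c :* d := a :* (b :- d) :+ d :* (a :- c)) refl
      where open +-*-Solver

fromℚ : ℚ → ℝ
fromℚ q = record { seq = λ _ → q ; isCauchy = const-cauchy q }

fromℤ : ℤ → ℝ
fromℤ i = fromℚ (i ℚ./ 1)

0ᴿ : ℝ
0ᴿ = fromℚ 0ℚ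

infixl 6 _+ᴿ_ _-ᴿ_
infixl 7 _*ᴿ_
infix  8 -ᴿ_

_+ᴿ_ _*ᴿ_ : ℝ → ℝ → ℝ
x +ᴿ y = record
  { seq      = λ n → seq x n ℚ.+ seq y n
  ; isCauchy = +-cauchy (seq x) (seq y) (isCauchy x) (isCauchy y)
  }
x *ᴿ y = record
  { seq      = λ n → seq x n ℚ.* seq y n
  ; isCauchy = *-cauchy (seq x) (seq y) (isCauchy x) (isCauchy y)
  }

-ᴿ_ : ℝ → ℝ
-ᴿ x = record { seq = λ n → ℚ.- seq x n ; isCauchy = neg-cauchy (seq x) (isCauchy x) }

_-ᴿ_ : ℝ → ℝ → ℝ
x -ᴿ y = x +ᴿ (-ᴿ y)

ℝ² : Set
ℝ² = ℝ × ℝ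

infix 4 _≈²_
_≈²_ : ℝ² → ℝ² → Set
(x , y) ≈² (x′ , y′) = x ≈ᴿ x′ × y ≈ᴿ y′

infixr 7 _·_
_·_ : ℝ → ℝ² → ℝ²
t · (x , y) = t *ᴿ x , t *ᴿ y

-- A line through the origin is given by a direction vector; it consists of
-- the real multiples of that vector.
record Line : Set where
  field
    direction : ℝ²
    nonzero   : ¬ (direction ≈² (0ᴿ , 0ᴿ))

open Line public

On : Line → Pred ℝ² 0ℓ
On ℒ p = ∃[ t ] p ≈² t · direction ℒ

-- "Side" means side of the origin within ℒ, the origin itself excluded.
OnPositiveSide OnNegativeSide : Line → Pred ℝ² 0ℓ
OnPositiveSide ℒ p = ∃[ t ] (0ᴿ <ᴿ t × p ≈² t · direction ℒ)
OnNegativeSide ℒ p = ∃[ t ] (t <ᴿ 0ᴿ × p ≈² t · direction ℒ)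

det : ℝ² → ℝ² → ℝ
det (a , b) (x , y) = a *ᴿ y -ᴿ b *ᴿ x

-- Closed half-planes: det (direction ℒ) vanishes exactly on ℒ.
LeftHalfPlane RightHalfPlane : Line → Pred ℝ² 0ℓ
LeftHalfPlane  ℒ p = 0ᴿ ≤ᴿ det (direction ℒ) p
RightHalfPlane ℒ p = det (direction ℒ) p ≤ᴿ 0ᴿ

ℤ-group ℤ²-group : AbelianGroup 0ℓ 0ℓ
ℤ-group  = +-0-abelianGroup
ℤ²-group = ℤ-group ×ᵃᵇ ℤ-group

ℤ² : Set
ℤ² = ℤ × ℤ

private module ℤ² = AbelianGroup ℤ²-group

O : ℤ²
O = ℤ².ε

ι : ℤ² → ℝ²
ι (x , y) = fromℤ x , fromℤ y

infix 4 _⊆ᴸ_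
_⊆ᴸ_ : Pred ℤ² 0ℓ → Line → Set
X ⊆ᴸ ℒ = X ⊆ (ι ⊢ On ℒ)

BothSides : Pred ℤ² 0ℓ → Line → Set
BothSides X ℒ = (∃[ p ] (p ∈ X × ι p ∈ OnPositiveSide ℒ))
              × (∃[ p ] (p ∈ X × ι p ∈ OnNegativeSide ℒ))

-- The Weak Line Condition; the bounding line may have irrational slope.
WLC : Pred ℤ² 0ℓ → Set
WLC X = ∃[ ℒ ] (X ⊆ (ι ⊢ LeftHalfPlane ℒ) ⊎ X ⊆ (ι ⊢ RightHalfPlane ℒ))

-- The smallest submonoid of ℤ² containing X.
data ⟨_⟩ (X : Pred ℤ² 0ℓ) : Pred ℤ² 0ℓ where
  gen  : ∀ {p} → p ∈ X → p ∈ ⟨ X ⟩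
  zero : O ∈ ⟨ X ⟩
  add  : ∀ {p q} → p ∈ ⟨ X ⟩ → q ∈ ⟨ X ⟩ → (p ℤ².∙ q) ∈ ⟨ X ⟩

-- Elements are points together with a membership derivation; equality
-- compares only the points.
𝒜 : Pred ℤ² 0ℓ → Monoid 0ℓ 0ℓ
𝒜 X = record
  { Carrier  = Σ ℤ² ⟨ X ⟩
  ; _≈_      = λ a b → proj₁ a ℤ².≈ proj₁ b
  ; _∙_      = λ a b → proj₁ a ℤ².∙ proj₁ b , add (proj₂ a) (proj₂ b)
  ; ε        = O , zero
  ; isMonoid = record
    { isSemigroup = record
      { isMagma = record
        { isEquivalence = record { refl = ℤ².refl ; sym = ℤ².sym ; trans = ℤ².trans }
        ; ∙-cong        = ℤ².∙-cong
        }
      ; assoc = λ a b c → ℤ².assoc (proj₁ a) (proj₁ b) (proj₁ c)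
      }
    ; identity = (λ a → ℤ².identityˡ (proj₁ a)) , (λ a → ℤ².identityʳ (proj₁ a))
    }
  }

module _ {c ℓ : Level} (M : Monoid c ℓ) where
  open Monoid M

  IsAGroup : Set (c ⊔ ℓ)
  IsAGroup = ∃ λ (inv : Op₁ Carrier) → IsGroup _≈_ _∙_ ε inv

  IsATrivialGroup : Set (c ⊔ ℓ)
  IsATrivialGroup = IsAGroup × (∀ a → a ≈ ε)

  toGroup : IsAGroup → Group c ℓ
  toGroup (_ , isGroup) = record { isGroup = isGroup }

infix 4 _≅_
_≅_ : ∀ {c ℓ c′ ℓ′} → Group c ℓ → Group c′ ℓ′ → Set (c ⊔ ℓ ⊔ c′ ⊔ ℓ′)
G ≅ H = ∃[ f ] IsGroupIsomorphism f
  where open GroupMorphisms (Group.rawGroup G) (Group.rawGroup H)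

{-# OPTIONS --safe #-}
-- 𝒜 X is a group exactly when it contains - x for every x ∈ X. On a line this
-- follows from a step q opposite to x, since |x|² q = (x · q) x with x · q < 0.
-- In the plane, let x ∈ X, let y ∈ X lie to its left and z ∈ X to its right. If
-- some step is opposite to x, or det y z > 0 for some such y and z, then - x is
-- obtained from det y z · x + det z x · y + det x y · z = 0. Otherwise the
-- cotangents dot x z / det x z of the right steps lie below the cotangents
-- dot x y / det x y of the left ones, and a real number r between them is the
-- cotangent of a line bounding a half-plane that contains X, so WLC holds.
-- Conversely a functional that is nonnegative on a group vanishes on it, which
-- puts X on a line. The isomorphisms come from subgroups of ℤ being cyclic: in
-- the collinear case applied to the values x · 𝒜 X, in the planar case to the
-- first coordinates and then to the kernel of the first coordinate.
module Submission where

open import Algebra.Bundles using (AbelianGroup; Group; Monoid)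
import Algebra.Properties.AbelianGroup
open import Axiom.ExcludedMiddle using (ExcludedMiddle)
open import Data.Empty using (⊥; ⊥-elim)
open import Data.Integer.Base as ℤ using (ℤ; +_; -[1+_]; +[1+_]; 0ℤ; 1ℤ)
import Data.Integer.DivMod as ℤ
import Data.Integer.Properties as ℤ
import Data.Integer.Tactic.RingSolver as ℤ-Solver
open import Data.Nat.Base as ℕ using (ℕ; zero; suc)
open import Data.Nat.Induction using (<-rec)
import Data.Nat.Properties as ℕ
open import Data.Product.Base using (Σ; ∃; ∃-syntax; _×_; _,_; proj₁; proj₂)
open import Data.Rational.Base as ℚ using (ℚ; mkℚ; 0ℚ; 1ℚ; ½)
import Data.Rational.Literals as ℚ using (fromℤ)
import Data.Rational.Properties as ℚ
open import Data.Sum.Base as Sum using (_⊎_; inj₁; inj₂)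
open import Function.Base using (case_of_)
open import Function.Bundles using (_⇔_; mk⇔)
open import Level using (Level; 0ℓ)
open import Relation.Binary.Definitions using (tri<; tri≈; tri>)
open import Relation.Binary.PropositionalEquality using (_≡_; _≢_; refl; sym; trans; cong; cong₂; subst; subst₂; module ≡-Reasoning)
open import Relation.Nullary.Decidable.Core using (yes; no; dec⇒maybe; decidable-stable)
open import Relation.Nullary.Negation.Core using (¬_)
open import Relation.Unary using (Pred; _∈_; _∉_; _⊆_; _⊢_; Empty; Satisfiable)
import Tactic.RingSolver as RingSolver
open import Tactic.RingSolver.Core.AlmostCommutativeRing using (AlmostCommutativeRing; fromCommutativeRing)
open import Defs

-- Group isomorphisms obtained from an inverse map.

module _ {c ℓ c′ ℓ′ : Level} (G : Group c ℓ) (H : Group c′ ℓ′) where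
  private
    module G = Group G
    module H = Group H
  open import Algebra.Properties.Group G using (inverseˡ-unique; identityˡ-unique)
  open import Relation.Binary.Reasoning.Setoid G.setoid

  -- In the uses below `h` is an explicit combination of basis vectors, while `f` only reads off
  -- coordinates. Each property of `f` reduces, through the injectivity of `h` and `h (f a) ≈ a`, to
  -- a property of `h`.
  ≅-fromInverse : (h : H.Carrier → G.Carrier) →
    (∀ {x y} → x H.≈ y → h x G.≈ h y) →
    (∀ x y → h (x H.∙ y) G.≈ h x G.∙ h y) →
    (∀ {x y} → h x G.≈ h y → x H.≈ y) →
    (f : G.Carrier → H.Carrier) → (∀ a → h (f a) G.≈ a) →
    G ≅ H
  ≅-fromInverse h h-cong h-homo h-inj f hf = f , record
    { isGroupMonomorphism = record
      { isGroupHomomorphism = record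
        { isMonoidHomomorphism = record
          { isMagmaHomomorphism = record
            { isRelHomomorphism = record { cong = λ {a} {b} a≈b →
                h-inj (G.trans (hf a) (G.trans a≈b (G.sym (hf b)))) }
            ; homo = λ a b → h-inj (begin
                h (f (a G.∙ b))      ≈⟨ hf (a G.∙ b) ⟩
                a G.∙ b              ≈⟨ G.∙-cong (hf a) (hf b) ⟨
                h (f a) G.∙ h (f b)  ≈⟨ h-homo (f a) (f b) ⟨
                h (f a H.∙ f b)      ∎)
            }
          ; ε-homo = h-inj (G.trans (hf G.ε) (G.sym hε))
          }
        ; ⁻¹-homo = λ a → h-inj (begin
            h (f (a G.⁻¹))   ≈⟨ hf (a G.⁻¹) ⟩
            a G.⁻¹           ≈⟨ G.⁻¹-cong (hf a) ⟨
            h (f a) G.⁻¹     ≈⟨ h⁻¹ (f a) ⟨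
            h (f a H.⁻¹)     ∎)
        }
      ; injective = λ {a} {b} fa≈fb → G.trans (G.sym (hf a)) (G.trans (h-cong fa≈fb) (hf b))
      }
    ; surjective = λ y → h y , λ {z} z≈hy → h-inj (G.trans (hf z) z≈hy)
    }
    where
    hε : h H.ε G.≈ G.ε
    hε = identityˡ-unique (h H.ε) (h H.ε) (G.trans (G.sym (h-homo H.ε H.ε)) (h-cong (H.identityˡ H.ε)))
    h⁻¹ : ∀ x → h (x H.⁻¹) G.≈ h x G.⁻¹
    h⁻¹ x = inverseˡ-unique (h (x H.⁻¹)) (h x) (begin
      h (x H.⁻¹) G.∙ h x  ≈⟨ h-homo (x H.⁻¹) x ⟨
      h (x H.⁻¹ H.∙ x)    ≈⟨ h-cong (H.inverseˡ x) ⟩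
      h H.ε               ≈⟨ hε ⟩
      G.ε                 ∎)

module _ where
  open import Data.Integer.Base using (_+_; _*_; _-_; -_; _≤_; _<_)
  open ℤ-Solver using (solve-∀)

  -- The plane lattice

  infixl 6 _⊕_
  infixr 7 _⊛_
  infix  8 ⊖_

  _⊕_ : ℤ² → ℤ² → ℤ²
  (a , b) ⊕ (c , d) = a + c , b + d

  ⊖_ : ℤ² → ℤ²
  ⊖ (a , b) = - a , - b

  _⊛_ : ℤ → ℤ² → ℤ²
  k ⊛ (a , b) = k * a , k * b

  -- For p nonzero, `detℤ p q` is positive when q lies to the left of p and negative when it lies to
  -- the right. When it is zero, q is a multiple of p and `dotℤ p q` has the sign of the factor.
  detℤ dotℤ : ℤ² → ℤ² → ℤ
  detℤ (a , b) (c , d) = a * d - b * c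
  dotℤ (a , b) (c , d) = a * c + b * d

  det-antisym : ∀ p q → detℤ q p ≡ - detℤ p q
  det-antisym (a , b) (c , d) = lem a b c d
    where
    lem : ∀ a b c d → c * b - d * a ≡ - (a * d - b * c)
    lem = solve-∀

  dot-comm : ∀ p q → dotℤ q p ≡ dotℤ p q
  dot-comm (a , b) (c , d) = cong₂ _+_ (ℤ.*-comm c a) (ℤ.*-comm d b)

  dot-⊛ : ∀ p k q → dotℤ p (k ⊛ q) ≡ k * dotℤ p q
  dot-⊛ (a , b) k (c , d) = lem a b k c d
    where
    lem : ∀ a b k c d → a * (k * c) + b * (k * d) ≡ k * (a * c + b * d)
    lem = solve-∀

  det-O : ∀ p → detℤ p O ≡ 0ℤ
  det-O (a , b) = lem a b
    where
    lem : ∀ a b → a * 0ℤ - b * 0ℤ ≡ 0ℤ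
    lem = solve-∀

  dot-O : ∀ p → dotℤ p O ≡ 0ℤ
  dot-O (a , b) = lem a b
    where
    lem : ∀ a b → a * 0ℤ + b * 0ℤ ≡ 0ℤ
    lem = solve-∀

  dot-⊖ : ∀ p q → dotℤ p (⊖ q) ≡ - dotℤ p q
  dot-⊖ (a , b) (c , d) = lem a b c d
    where
    lem : ∀ a b c d → a * - c + b * - d ≡ - (a * c + b * d)
    lem = solve-∀

  det-⊕ : ∀ p q r → detℤ p (q ⊕ r) ≡ detℤ p q + detℤ p r
  det-⊕ (a , b) (c , d) (e , f) = lem a b c d e f
    where
    lem : ∀ a b c d e f → a * (d + f) - b * (c + e) ≡ (a * d - b * c) + (a * f - b * e)
    lem = solve-∀

  dot-⊕ : ∀ p q r → dotℤ p (q ⊕ r) ≡ dotℤ p q + dotℤ p r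
  dot-⊕ (a , b) (c , d) (e , f) = lem a b c d e f
    where
    lem : ∀ a b c d e f → a * (c + e) + b * (d + f) ≡ (a * c + b * d) + (a * e + b * f)
    lem = solve-∀

  dot-⊛ˡ : ∀ k p q → dotℤ (k ⊛ p) q ≡ k * dotℤ p q
  dot-⊛ˡ k p q = trans (dot-comm q (k ⊛ p)) (trans (dot-⊛ q k p) (cong (k *_) (dot-comm p q)))

  *-cancel : ∀ {g m n} → g ≢ 0ℤ → m * g ≡ n * g → m ≡ n
  *-cancel {g} {m} {n} g≢0 = ℤ.*-cancelʳ-≡ m n g {{ℤ.≢-nonZero g≢0}}

  -- Each coordinate is a 3 by 3 determinant with a repeated row, expanded along that row.
  cramer : ∀ x y z → detℤ y z ⊛ x ⊕ (detℤ z x ⊛ y ⊕ detℤ x y ⊛ z) ≡ O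
  cramer (a , b) (c , d) (e , f) = cong₂ _,_ (lem₁ a b c d e f) (lem₂ a b c d e f)
    where
    lem₁ : ∀ a b c d e f → (c * f - d * e) * a + ((e * b - f * a) * c + (a * d - b * c) * e) ≡ 0ℤ
    lem₁ = solve-∀
    lem₂ : ∀ a b c d e f → (c * f - d * e) * b + ((e * b - f * a) * d + (a * d - b * c) * f) ≡ 0ℤ
    lem₂ = solve-∀

  0<n*n : ∀ {n} → n ≢ 0ℤ → 0ℤ < n * n
  0<n*n {+ zero}   n≢0 = ⊥-elim (n≢0 refl)
  0<n*n {+[1+ n ]} n≢0 = ℤ.+<+ (ℕ.s≤s ℕ.z≤n)
  0<n*n { -[1+ n ]} n≢0 = ℤ.+<+ (ℕ.s≤s ℕ.z≤n)

  0≤n*n : ∀ n → 0ℤ ≤ n * n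
  0≤n*n (+ zero)  = ℤ.≤-refl
  0≤n*n +[1+ n ]  = ℤ.+≤+ ℕ.z≤n
  0≤n*n -[1+ n ]  = ℤ.+≤+ ℕ.z≤n

  norm-pos : ∀ {p} → p ≢ O → 0ℤ < dotℤ p p
  norm-pos {a , b} p≢O with a ℤ.≟ 0ℤ | b ℤ.≟ 0ℤ
  ... | no a≢0  | _        = ℤ.+-mono-<-≤ (0<n*n a≢0) (0≤n*n b)
  ... | yes _   | no b≢0   = ℤ.+-mono-≤-< (0≤n*n a) (0<n*n b≢0)
  ... | yes a≡0 | yes b≡0  = ⊥-elim (p≢O (cong₂ _,_ a≡0 b≡0))

  0<m*n : ∀ {m n} → 0ℤ < m → 0ℤ < n → 0ℤ < m * n
  0<m*n {+[1+ _ ]} {+[1+ _ ]} _ _ = ℤ.+<+ (ℕ.s≤s ℕ.z≤n)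
  0<m*n {+ zero} (ℤ.+<+ ()) _
  0<m*n {_} {+ zero} _ (ℤ.+<+ ())

  0≤m*n : ∀ {m n} → 0ℤ ≤ m → 0ℤ ≤ n → 0ℤ ≤ m * n
  0≤m*n {m} {n} 0≤m 0≤n = ℤ.≤-trans (ℤ.≤-reflexive (sym (ℤ.*-zeroʳ m))) (ℤ.*-monoˡ-≤-nonNeg m {{ℤ.nonNegative 0≤m}} 0≤n)

  -- In general |p|² q = (p · q) p + (det p q) p⊥, where p⊥ is the quarter turn of p; the hypothesis
  -- removes the last term.
  dot-parallel : ∀ p q → detℤ p q ≡ 0ℤ → dotℤ p p ⊛ q ≡ dotℤ p q ⊛ p
  dot-parallel (a , b) (c , d) e = cong₂ _,_
    (trans (lem₁ a b c d) (trans (cong (λ z → (a * c + b * d) * a - z * b) e) (lem₀ _ b)))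
    (trans (lem₂ a b c d) (trans (cong (λ z → (a * c + b * d) * b + z * a) e) (lem₃ _ a)))
    where
    lem₁ : ∀ a b c d → (a * a + b * b) * c ≡ (a * c + b * d) * a - (a * d - b * c) * b
    lem₁ = solve-∀
    lem₂ : ∀ a b c d → (a * a + b * b) * d ≡ (a * c + b * d) * b + (a * d - b * c) * a
    lem₂ = solve-∀
    lem₀ : ∀ x b → x - 0ℤ * b ≡ x
    lem₀ = solve-∀
    lem₃ : ∀ x b → x + 0ℤ * b ≡ x
    lem₃ = solve-∀

  -- `dot-parallel` recovers |p|² q from p · q, and |p|² can be cancelled. Thus `dotℤ p` is an
  -- injective coordinate on the line through p.
  det-dot-unique : ∀ {p q r} → p ≢ O → detℤ p q ≡ 0ℤ → detℤ p r ≡ 0ℤ → dotℤ p q ≡ dotℤ p r → q ≡ r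
  det-dot-unique {p} {q} {r} p≢O e e′ f =
    cong₂ _,_ (cancel _ _ (cong proj₁ eq)) (cancel _ _ (cong proj₂ eq))
    where
    eq : dotℤ p p ⊛ q ≡ dotℤ p p ⊛ r
    eq = trans (dot-parallel p q e) (trans (cong (_⊛ p) f) (sym (dot-parallel p r e′)))
    cancel : ∀ x y → dotℤ p p * x ≡ dotℤ p p * y → x ≡ y
    cancel x y = ℤ.*-cancelˡ-≡ (dotℤ p p) x y {{ℤ.≢-nonZero (λ z → ℤ.<-irrefl (sym z) (norm-pos p≢O))}}

  -- Subgroups of ℤ

  module _ (em : ExcludedMiddle 0ℓ) where

    -- Descent by well-founded induction, with excluded middle settling at each stage whether a
    -- smaller witness exists.
    least : (P : Pred ℕ 0ℓ) → ∃ P → ∃[ n ] (P n × (∀ m → m ℕ.< n → ¬ P m))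
    least P (n , p) = <-rec Q step n p
      where
      Q : Pred ℕ 0ℓ
      Q n = P n → ∃[ n ] (P n × (∀ m → m ℕ.< n → ¬ P m))
      step : ∀ n → (∀ {m} → m ℕ.< n → Q m) → Q n
      step n rec p with em {∃[ m ] (m ℕ.< n × P m)}
      ... | yes (m , m<n , pm) = rec m<n pm
      ... | no none            = n , p , λ m m<n pm → none (m , m<n , pm)

    -- The generator is the least positive element: the remainder of any element on division by it
    -- lies in `P` again and is smaller, hence zero.
    subgroup-cyclic : (P : Pred ℤ 0ℓ) → (∀ {a b} → P a → P b → P (a + b)) → (∀ {a} → P a → P (- a)) →
      ∀ a → a ≢ 0ℤ → P a → ∃[ g ] (g ≢ 0ℤ × P g × (∀ {a} → P a → ∃[ m ] a ≡ m * g))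
    -- Positive integers are indexed from zero: index n stands for n + 1.
    subgroup-cyclic P P-+ P-neg a a≢0 Pa with least (λ n → P +[1+ n ]) (pos a a≢0 Pa)
      where
      pos : ∀ a → a ≢ 0ℤ → P a → ∃[ n ] P +[1+ n ]
      pos (+ zero)  a≢0 _  = ⊥-elim (a≢0 refl)
      pos +[1+ n ]  _   Pa = n , Pa
      pos -[1+ n ]  _   Pa = n , P-neg Pa
    ... | n , Pg , minimal = g , (λ ()) , Pg , λ {b} Pb → b ℤ./ℕ suc n , div b Pb
      where
      g = +[1+ n ]
      P-0 : P 0ℤ
      P-0 = subst P (ℤ.+-inverseʳ g) (P-+ Pg (P-neg Pg))
      P-*ℕ : ∀ k → P (+ k * g)
      P-*ℕ zero    = subst P (sym (ℤ.*-zeroˡ g)) P-0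
      P-*ℕ (suc k) = subst P (sym (ℤ.suc-* (+ k) g)) (P-+ Pg (P-*ℕ k))
      P-* : ∀ k → P (k * g)
      P-* (+ k)     = P-*ℕ k
      P-* -[1+ k ]  = subst P (ℤ.neg-distribˡ-* (+ suc k) g) (P-neg (P-*ℕ (suc k)))
      div : ∀ b → P b → b ≡ b ℤ./ℕ suc n * g
      div b Pb = trans eq (trans (cong (λ r → + r + q * g) (r≡0 (b ℤ.%ℕ suc n) (ℤ.n%ℕd<d b (suc n)) Pr)) (ℤ.+-identityˡ _))
        where
        q = b ℤ./ℕ suc n
        eq : b ≡ + (b ℤ.%ℕ suc n) + q * g
        eq = ℤ.a≡a%ℕn+[a/ℕn]*n b (suc n)
        lem : ∀ x y → (x + y) + - y ≡ x
        lem = solve-∀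
        Pr : P (+ (b ℤ.%ℕ suc n))
        Pr = subst P (trans (cong (_+ - (q * g)) eq) (lem _ (q * g))) (P-+ Pb (P-neg (P-* q)))
        r≡0 : ∀ r → r ℕ.< suc n → P (+ r) → r ≡ 0
        r≡0 zero    _          _  = refl
        r≡0 (suc r) (ℕ.s≤s lt) Pr = ⊥-elim (minimal r lt Pr)

  -- Submonoids of ℤ²

  module _ {X : Pred ℤ² 0ℓ} where

    ⊛ℕ-closed : ∀ n {p} → p ∈ ⟨ X ⟩ → (+ n ⊛ p) ∈ ⟨ X ⟩
    ⊛ℕ-closed zero    _ = zero
    ⊛ℕ-closed (suc n) {a , b} p∈ =
      subst ⟨ X ⟩ (cong₂ _,_ (sym (ℤ.suc-* (+ n) a)) (sym (ℤ.suc-* (+ n) b))) (add p∈ (⊛ℕ-closed n p∈))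

    ⊛-closed⁺ : ∀ {k p} → 0ℤ ≤ k → p ∈ ⟨ X ⟩ → (k ⊛ p) ∈ ⟨ X ⟩
    ⊛-closed⁺ {+ n} _ = ⊛ℕ-closed n

    neg-closed : (∀ {p} → p ∈ X → (⊖ p) ∈ ⟨ X ⟩) → ∀ {p} → p ∈ ⟨ X ⟩ → (⊖ p) ∈ ⟨ X ⟩
    neg-closed h (gen p∈) = h p∈
    neg-closed h zero     = zero
    neg-closed h (add {a , b} {c , d} p∈ q∈) =
      subst ⟨ X ⟩ (cong₂ _,_ (sym (ℤ.neg-distrib-+ a c)) (sym (ℤ.neg-distrib-+ b d)))
        (add (neg-closed h p∈) (neg-closed h q∈))

    -- Because - q = (k - 1) q + w.
    neg-member : ∀ {k q w} → 0ℤ < k → k ⊛ q ⊕ w ≡ O → q ∈ ⟨ X ⟩ → w ∈ ⟨ X ⟩ → (⊖ q) ∈ ⟨ X ⟩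
    neg-member {+ zero} (ℤ.+<+ ())
    neg-member {+[1+ n ]} {a , b} {c , d} _ e q∈ w∈ =
      subst ⟨ X ⟩ (cong₂ _,_ (lem′ a c (cong proj₁ e)) (lem′ b d (cong proj₂ e)))
        (add (⊛ℕ-closed n q∈) w∈)
      where
      lem : ∀ n a c → n * a + c ≡ - a + ((1ℤ + n) * a + c)
      lem = solve-∀
      lem′ : ∀ a c → (1ℤ + + n) * a + c ≡ 0ℤ → + n * a + c ≡ - a
      lem′ a c e = trans (lem (+ n) a c) (trans (cong (_+_ (- a)) e) (ℤ.+-identityʳ (- a)))

    isAGroup⁺ : (∀ {p} → p ∈ ⟨ X ⟩ → (⊖ p) ∈ ⟨ X ⟩) → IsAGroup (𝒜 X)
    isAGroup⁺ neg = (λ a → ⊖ proj₁ a , neg (proj₂ a)) , record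
      { isMonoid = Monoid.isMonoid (𝒜 X)
      ; inverse  = (λ a → ℤ².inverseˡ (proj₁ a)) , (λ a → ℤ².inverseʳ (proj₁ a))
      ; ⁻¹-cong  = ℤ².⁻¹-cong
      }
      where
      module ℤ² = AbelianGroup ℤ²-group

    -- The given inverse operation returns some point with a derivation; uniqueness of inverses in
    -- ℤ² identifies that point with - p.
    isAGroup⁻ : IsAGroup (𝒜 X) → ∀ {p} → p ∈ ⟨ X ⟩ → (⊖ p) ∈ ⟨ X ⟩
    isAGroup⁻ g {p} p∈ = subst ⟨ X ⟩ (cong₂ _,_ (proj₁ eq) (proj₂ eq)) (proj₂ (a G.⁻¹))
      where
      module G = Group (toGroup (𝒜 X) g)
      a = p , p∈
      open import Algebra.Properties.AbelianGroup ℤ²-group using (inverseˡ-unique)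
      eq = inverseˡ-unique (proj₁ (a G.⁻¹)) p (G.inverseˡ a)

    ⊛-closed : (∀ {p} → p ∈ ⟨ X ⟩ → (⊖ p) ∈ ⟨ X ⟩) → ∀ k {p} → p ∈ ⟨ X ⟩ → (k ⊛ p) ∈ ⟨ X ⟩
    ⊛-closed neg (+ n)          p∈ = ⊛ℕ-closed n p∈
    ⊛-closed neg -[1+ n ] {a , b} p∈ =
      subst ⟨ X ⟩ (cong₂ _,_ (ℤ.neg-distribˡ-* +[1+ n ] a) (ℤ.neg-distribˡ-* +[1+ n ] b))
        (neg (⊛ℕ-closed (suc n) p∈))

    det-vanishes : ∀ p → (∀ {q} → q ∈ X → detℤ p q ≡ 0ℤ) → ∀ {q} → q ∈ ⟨ X ⟩ → detℤ p q ≡ 0ℤ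
    det-vanishes p h (gen q∈) = h q∈
    det-vanishes p h zero     = det-O p
    det-vanishes p h (add {q} {r} q∈ r∈) =
      trans (det-⊕ p q r) (cong₂ _+_ (det-vanishes p h q∈) (det-vanishes p h r∈))

    dot-nonneg : ∀ p → (∀ {q} → q ∈ X → 0ℤ ≤ dotℤ p q) → ∀ {q} → q ∈ ⟨ X ⟩ → 0ℤ ≤ dotℤ p q
    dot-nonneg p h (gen q∈) = h q∈
    dot-nonneg p h zero     = ℤ.≤-reflexive (sym (dot-O p))
    dot-nonneg p h (add {q} {r} q∈ r∈) =
      ℤ.≤-trans (ℤ.+-mono-≤ (dot-nonneg p h q∈) (dot-nonneg p h r∈)) (ℤ.≤-reflexive (sym (dot-⊕ p q r)))

module _ where
  open import Data.Rational.Base using (∣_∣; _+_; _*_; _-_; -_; _<_; _≤_; _/_)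
  open RingSolver using (solve-∀)

  -- The embedding of ℤ in ℚ

  ℚ-ring : AlmostCommutativeRing 0ℓ 0ℓ
  ℚ-ring = fromCommutativeRing ℚ.+-*-commutativeRing (λ q → dec⇒maybe (0ℚ ℚ.≟ q))

  ⟦_⟧ : ℤ → ℚ
  ⟦ i ⟧ = i / 1

  -- `i / 1` is normalised through a gcd and does not reduce for a variable i, whereas `ℚ.fromℤ i`
  -- has denominator 1 by construction. Rewriting with this reduces the lemmas below to integer
  -- arithmetic.
  ⟦⟧-fromℤ : ∀ i → ⟦ i ⟧ ≡ ℚ.fromℤ i
  ⟦⟧-fromℤ i = ℚ.↥p/↧p≡p (ℚ.fromℤ i)

  ⟦⟧-+ : ∀ i j → ⟦ i ℤ.+ j ⟧ ≡ ⟦ i ⟧ + ⟦ j ⟧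
  ⟦⟧-+ i j rewrite ⟦⟧-fromℤ i | ⟦⟧-fromℤ j =
    sym (cong (_/ 1) (cong₂ ℤ._+_ (ℤ.*-identityʳ i) (ℤ.*-identityʳ j)))

  ⟦⟧-* : ∀ i j → ⟦ i ℤ.* j ⟧ ≡ ⟦ i ⟧ * ⟦ j ⟧
  ⟦⟧-* i j rewrite ⟦⟧-fromℤ i | ⟦⟧-fromℤ j = refl

  ⟦⟧-neg : ∀ i → ⟦ ℤ.- i ⟧ ≡ - ⟦ i ⟧
  ⟦⟧-neg i rewrite ⟦⟧-fromℤ i | ⟦⟧-fromℤ (ℤ.- i) = neg i
    where
    neg : ∀ i → ℚ.fromℤ (ℤ.- i) ≡ - ℚ.fromℤ i
    neg (+ zero)  = refl
    neg +[1+ n ]  = refl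
    neg -[1+ n ]  = refl

  ⟦⟧-≤ : ∀ {i j} → i ℤ.≤ j → ⟦ i ⟧ ≤ ⟦ j ⟧
  ⟦⟧-≤ {i} {j} i≤j rewrite ⟦⟧-fromℤ i | ⟦⟧-fromℤ j = ℚ.*≤* (ℤ.*-monoʳ-≤-nonNeg 1ℤ i≤j)

  ⟦⟧-< : ∀ {i j} → i ℤ.< j → ⟦ i ⟧ < ⟦ j ⟧
  ⟦⟧-< {i} {j} i<j rewrite ⟦⟧-fromℤ i | ⟦⟧-fromℤ j = ℚ.*<* (ℤ.*-monoʳ-<-pos 1ℤ i<j)

  ⟦⟧≡0 : ∀ {i} → ⟦ i ⟧ ≡ 0ℚ → i ≡ 0ℤ
  ⟦⟧≡0 {i} e = ℚ.p≡0⇒↥p≡0 (ℚ.fromℤ i) (trans (sym (⟦⟧-fromℤ i)) e)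

  ⟦det⟧ : ∀ a b c d → ⟦ detℤ (a , b) (c , d) ⟧ ≡ ⟦ a ⟧ * ⟦ d ⟧ - ⟦ b ⟧ * ⟦ c ⟧
  ⟦det⟧ a b c d = trans (⟦⟧-+ (a ℤ.* d) (ℤ.- (b ℤ.* c)))
    (cong₂ _+_ (⟦⟧-* a d) (trans (⟦⟧-neg (b ℤ.* c)) (cong -_ (⟦⟧-* b c))))

  ⟦dot⟧ : ∀ a b c d → ⟦ dotℤ (a , b) (c , d) ⟧ ≡ ⟦ a ⟧ * ⟦ c ⟧ + ⟦ b ⟧ * ⟦ d ⟧
  ⟦dot⟧ a b c d = trans (⟦⟧-+ (a ℤ.* c) (b ℤ.* d)) (cong₂ _+_ (⟦⟧-* a c) (⟦⟧-* b d))

  -- Inequalities between rationals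

  -- Adding r - p to both sides moves p to r and q to s. Rearranging an inequality thus becomes a
  -- ring identity for the solver.
  <-shift : ∀ {p q} r s → q - p ≡ s - r → p < q → r < s
  <-shift {p} {q} r s e p<q = ℚ.<-respˡ-≡ (lem₁ p r) (ℚ.<-respʳ-≡ eq (ℚ.+-monoˡ-< (r - p) p<q))
    where
    lem₁ : ∀ p r → p + (r - p) ≡ r
    lem₁ = solve-∀ ℚ-ring
    lem₂ : ∀ p q r → q + (r - p) ≡ (q - p) + r
    lem₂ = solve-∀ ℚ-ring
    lem₃ : ∀ r s → (s - r) + r ≡ s
    lem₃ = solve-∀ ℚ-ring
    eq : q + (r - p) ≡ s
    eq = trans (lem₂ p q r) (trans (cong (_+ r) e) (lem₃ r s))

  halve : ∀ {ε} → 0ℚ < ε → ∃[ δ ] (0ℚ < δ × ε ≡ δ + δ)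
  halve {ε} 0<ε = ε * ½ , ℚ.positive⁻¹ _ {{ℚ.pos*pos⇒pos ε {{ℚ.positive 0<ε}} ½}} , eq
    where
    eq : ε ≡ ε * ½ + ε * ½
    eq = sym (trans (sym (ℚ.*-distribˡ-+ ε ½ ½)) (ℚ.*-identityʳ ε))

  0<p*q : ∀ {p q} → 0ℚ < p → 0ℚ < q → 0ℚ < p * q
  0<p*q {p} {q} 0<p 0<q = ℚ.positive⁻¹ _ {{ℚ.pos*pos⇒pos p {{ℚ.positive 0<p}} q {{ℚ.positive 0<q}}}}

  recip : ∀ {B} → 0ℚ < B → ∃[ B⁻¹ ] (0ℚ < B⁻¹ × B * B⁻¹ ≡ 1ℚ)
  recip {B} 0<B = ℚ.1/ B , ℚ.positive⁻¹ _ {{ℚ.1/pos⇒pos B}} , ℚ.*-inverseʳ B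
    where
    instance
      B-pos : ℚ.Positive B
      B-pos = ℚ.positive 0<B
      B≢0 : ℚ.NonZero B
      B≢0 = ℚ.pos⇒nonZero B

  p≤∣p∣ : ∀ p → p ≤ ∣ p ∣
  p≤∣p∣ p with ℚ.≤-total 0ℚ p
  ... | inj₁ 0≤p = ℚ.≤-reflexive (sym (ℚ.0≤p⇒∣p∣≡p 0≤p))
  ... | inj₂ p≤0 = ℚ.≤-trans p≤0 (ℚ.0≤∣p∣ p)

  ∣∣<-upper : ∀ {p δ} → ∣ p ∣ < δ → p < δ
  ∣∣<-upper {p} = ℚ.≤-<-trans (p≤∣p∣ p)

  ∣∣<-lower : ∀ {p δ} → ∣ p ∣ < δ → - p < δ
  ∣∣<-lower {p} h = ∣∣<-upper (ℚ.<-respˡ-≡ (sym (ℚ.∣-p∣≡∣p∣ p)) h)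

  ∣∣<-intro : ∀ {p δ} → p < δ → - p < δ → ∣ p ∣ < δ
  ∣∣<-intro {p} h₁ h₂ with ℚ.∣p∣≡p∨∣p∣≡-p p
  ... | inj₁ e = ℚ.<-respˡ-≡ (sym e) h₁
  ... | inj₂ e = ℚ.<-respˡ-≡ (sym e) h₂

  -- Null sequences

  eventually₂ : ∀ {P Q R : ℕ → Set} → (∀ n → P n → Q n → R n) → Eventually P → Eventually Q → Eventually R
  eventually₂ f (M , p) (N , q) = M ℕ.⊔ N , λ n h →
    f n (p n (ℕ.m⊔n≤o⇒m≤o M N h)) (q n (ℕ.m⊔n≤o⇒n≤o M N h))

  eventually : ∀ {P Q : ℕ → Set} → (∀ n → P n → Q n) → Eventually P → Eventually Q
  eventually f (N , p) = N , λ n h → f n (p n h)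

  eventually-const : ∀ {P : Set} → Eventually (λ _ → P) → P
  eventually-const (N , p) = p N ℕ.≤-refl

  Null : Pred (ℕ → ℚ) 0ℓ
  Null u = ∀ ε → 0ℚ < ε → Eventually λ n → ∣ u n ∣ < ε

  null-resp : ∀ {u v} → (∀ n → u n ≡ v n) → Null u → Null v
  null-resp u≗v null ε 0<ε = eventually (λ n → ℚ.<-respˡ-≡ (cong ∣_∣ (u≗v n))) (null ε 0<ε)

  null-0 : ∀ {u} → (∀ n → u n ≡ 0ℚ) → Null u
  null-0 u≗0 ε 0<ε = 0 , λ n _ → ℚ.<-respˡ-≡ (sym (cong ∣_∣ (u≗0 n))) 0<ε

  -- Otherwise |q| itself could be taken as ε. This is how limits are turned back into exact
  -- equations between lattice coordinates.
  null-const : ∀ {q} → Null (λ _ → q) → q ≡ 0ℚ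
  null-const {q} null with ∣ q ∣ ℚ.≟ 0ℚ
  ... | yes e = ℚ.∣p∣≡0⇒p≡0 q e
  ... | no ∣q∣≢0 = ⊥-elim (ℚ.<-irrefl refl (eventually-const (null ∣ q ∣
          (ℚ.≰⇒> λ ∣q∣≤0 → ∣q∣≢0 (ℚ.≤-antisym ∣q∣≤0 (ℚ.0≤∣p∣ q))))))

  null-+ : ∀ {u v} → Null u → Null v → Null (λ n → u n + v n)
  null-+ {u} {v} nu nv ε 0<ε with halve 0<ε
  ... | δ , 0<δ , refl = eventually₂
    (λ n hu hv → ℚ.≤-<-trans (ℚ.∣p+q∣≤∣p∣+∣q∣ (u n) (v n)) (ℚ.+-mono-< hu hv)) (nu δ 0<δ) (nv δ 0<δ)

  null-neg : ∀ {u} → Null u → Null (λ n → - u n)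
  null-neg {u} nu ε 0<ε = eventually (λ n → ℚ.<-respˡ-≡ (sym (ℚ.∣-p∣≡∣p∣ (u n)))) (nu ε 0<ε)

  null-- : ∀ {u v} → Null u → Null v → Null (λ n → u n - v n)
  null-- nu nv = null-+ nu (null-neg nv)

  seq-bounded : ∀ x → ∃[ B ] (0ℚ < B × Eventually λ n → ∣ seq x n ∣ ≤ B)
  seq-bounded x with isCauchy x 1ℚ (ℚ.positive⁻¹ 1ℚ)
  ... | N , h = ∣ seq x N ∣ + 1ℚ , ℚ.+-mono-≤-< (ℚ.0≤∣p∣ (seq x N)) (ℚ.positive⁻¹ 1ℚ) , N , λ n p → begin
      ∣ seq x n ∣                        ≡⟨ cong ∣_∣ (lem (seq x N) (seq x n)) ⟩
      ∣ seq x N + (seq x n - seq x N) ∣  ≤⟨ ℚ.∣p+q∣≤∣p∣+∣q∣ (seq x N) (seq x n - seq x N) ⟩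
      ∣ seq x N ∣ + ∣ seq x n - seq x N ∣ ≤⟨ ℚ.+-monoʳ-≤ ∣ seq x N ∣ (ℚ.<⇒≤ (h n N p ℕ.≤-refl)) ⟩
      ∣ seq x N ∣ + 1ℚ                   ∎
    where
    open ℚ.≤-Reasoning
    lem : ∀ a b → b ≡ a + (b - a)
    lem = solve-∀ ℚ-ring

  null-* : ∀ x {u} → Null u → Null (λ n → seq x n * u n)
  null-* x {u} nu ε 0<ε = eventually₂ (λ n → step n (seq x n)) bounded (nu (B⁻¹ * ε) (0<p*q 0<B⁻¹ 0<ε))
    where
    B = proj₁ (seq-bounded x)
    0<B = proj₁ (proj₂ (seq-bounded x))
    bounded = proj₂ (proj₂ (seq-bounded x))
    B⁻¹ = proj₁ (recip 0<B)
    0<B⁻¹ = proj₁ (proj₂ (recip 0<B))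
    cancel : B * (B⁻¹ * ε) ≡ ε
    cancel = trans (sym (ℚ.*-assoc B B⁻¹ ε))
      (trans (cong (_* ε) (proj₂ (proj₂ (recip 0<B)))) (ℚ.*-identityˡ ε))
    step : ∀ n q → ∣ q ∣ ≤ B → ∣ u n ∣ < B⁻¹ * ε → ∣ q * u n ∣ < ε
    step n q hx hu = ℚ.<-respˡ-≡ (sym (ℚ.∣p*q∣≡∣p∣*∣q∣ q (u n))) (ℚ.≤-<-trans
      (ℚ.*-monoʳ-≤-nonNeg ∣ u n ∣ {{ℚ.∣-∣-nonNeg (u n)}} hx)
      (ℚ.<-respʳ-≡ cancel (ℚ.*-monoʳ-<-pos B {{ℚ.positive 0<B}} hu)))

  null-*ℚ : ∀ q {u} → Null u → Null (λ n → q * u n)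
  null-*ℚ q = null-* (fromℚ q)

  null-cancel-*ℚ : ∀ {q u} → q ≢ 0ℚ → Null (λ n → q * u n) → Null u
  null-cancel-*ℚ {q} {u} q≢0 nu = null-resp eq (null-*ℚ (ℚ.1/ q) nu)
    where
    instance
      q-nonZero : ℚ.NonZero q
      q-nonZero = ℚ.≢-nonZero q≢0
    eq : ∀ n → ℚ.1/ q * (q * u n) ≡ u n
    eq n = trans (sym (ℚ.*-assoc (ℚ.1/ q) q (u n)))
      (trans (cong (_* u n) (ℚ.*-inverseˡ q)) (ℚ.*-identityˡ (u n)))

  module _ (em : ExcludedMiddle 0ℓ) where

    -- Excluded middle at each of the three quantifiers turns failure of convergence into a margin
    -- that is attained arbitrarily late.
    non-null : ∀ {u} → ¬ Null u → ∃[ ε ] (0ℚ < ε × (∀ N → ∃[ n ] (N ℕ.≤ n × ε ≤ ∣ u n ∣)))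
    non-null {u} ¬null with em {∃[ ε ] (0ℚ < ε × (∀ N → ∃[ n ] (N ℕ.≤ n × ε ≤ ∣ u n ∣)))}
    ... | yes h = h
    ... | no  h = ⊥-elim (¬null null)
      where
      null : Null u
      null ε 0<ε with em {Eventually λ n → ∣ u n ∣ < ε}
      ... | yes ev = ev
      ... | no ¬ev = ⊥-elim (h (ε , 0<ε , often))
        where
        often : ∀ N → ∃[ n ] (N ℕ.≤ n × ε ≤ ∣ u n ∣)
        often N with em {∃[ n ] (N ℕ.≤ n × ε ≤ ∣ u n ∣)}
        ... | yes far = far
        ... | no ¬far = ⊥-elim (¬ev (N , λ n N≤n → ℚ.≰⇒> λ le → ¬far (n , N≤n , le)))

    -- Some late term has absolute value at least 2δ, and all later terms stay within δ of it, so
    -- they keep its sign with margin δ.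
    sign-of-nonzero : ∀ t → ¬ Null (seq t) → 0ᴿ <ᴿ t ⊎ t <ᴿ 0ᴿ
    sign-of-nonzero t ¬null with non-null ¬null
    ... | ε , 0<ε , often with halve 0<ε
    ... | δ , 0<δ , refl with isCauchy t δ 0<δ
    ... | N , close with often N
    ... | n , N≤n , far with ℚ.∣p∣≡p∨∣p∣≡-p (seq t n)
    ...   | inj₁ e = inj₁ (δ , 0<δ , N , λ m N≤m →
              <-shift (0ℚ + δ) (seq t m) (lem δ (seq t n) (seq t m))
                (ℚ.+-mono-<-≤ (∣∣<-upper (close n m N≤n N≤m)) (subst (δ + δ ≤_) e far)))
      where
      lem : ∀ δ a b → (δ + a) - ((a - b) + (δ + δ)) ≡ b - (0ℚ + δ)
      lem = solve-∀ ℚ-ring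
    ...   | inj₂ e = inj₂ (δ , 0<δ , N , λ m N≤m →
              <-shift (seq t m + δ) 0ℚ (lem δ (seq t n) (seq t m))
                (ℚ.+-mono-<-≤ (∣∣<-lower (close n m N≤n N≤m)) (subst (δ + δ ≤_) e far)))
      where
      lem : ∀ δ a b → (δ + - a) - (- (a - b) + (δ + δ)) ≡ 0ℚ - (b + δ)
      lem = solve-∀ ℚ-ring

  -- For points (a , b) and (c , d) with parameters t and s on the line directed by
  -- (x , y), the residuals a - t x, b - t y, c - s x and d - s y are null sequences.
  private
    subtract-add : ∀ a t x → (a - t * x) + x * t ≡ a
    subtract-add = solve-∀ ℚ-ring

    exchange-dot : ∀ a b c d t s x y →
      (a * (s * (a - t * x) - t * (c - s * x))) + (b * (s * (b - t * y) - t * (d - s * y)))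
      ≡ s * (a * a + b * b) - t * (a * c + b * d)
    exchange-dot = solve-∀ ℚ-ring

    flip-sum : ∀ S δ → 0ℚ - (S + δ) ≡ - S - δ
    flip-sum = solve-∀ ℚ-ring

    neg-difference : ∀ S N T D → - S * N + T * D ≡ - (S * N - T * D)
    neg-difference = solve-∀ ℚ-ring

    swap-factor : ∀ N M c → N * M * c ≡ M * (N * c)
    swap-factor = solve-∀ ℚ-ring

    scale-residual : ∀ k a t x → k * (a - t * x) ≡ k * a - k * t * x
    scale-residual = solve-∀ ℚ-ring

    scale-gap⁺ : ∀ k ε t → k * (0ℚ + ε) - k * t ≡ 0ℚ - (k * t + - (k * ε))
    scale-gap⁺ = solve-∀ ℚ-ring

    scale-gap⁻ : ∀ k ε t → k * (t + ε) - k * 0ℚ ≡ k * t - (0ℚ + - (k * ε))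
    scale-gap⁻ = solve-∀ ℚ-ring

    subtract-zero : ∀ a → a - 0ℚ ≡ a
    subtract-zero = solve-∀ ℚ-ring

    det-residuals : ∀ a b c d t s x y →
      (d * (a - t * x) - c * (b - t * y)) + (t * x * (d - s * y) - t * y * (c - s * x)) ≡ a * d - b * c
    det-residuals = solve-∀ ℚ-ring

    det-sum : ∀ x y a b c d → x * (b + d) - y * (a + c) ≡ (x * b - y * a) + (x * d - y * c)
    det-sum = solve-∀ ℚ-ring

    det-neg : ∀ x y a b → x * - b - y * - a ≡ - (x * b - y * a)
    det-neg = solve-∀ ℚ-ring

    det-zero : ∀ x y → x * 0ℚ - y * 0ℚ ≡ 0ℚ
    det-zero = solve-∀ ℚ-ring

    reflect-gap : ∀ x ε → (x + ε) - 0ℚ ≡ ε - - x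
    reflect-gap = solve-∀ ℚ-ring

    left-gap : ∀ x ε → (- x + ε) - 0ℚ ≡ (0ℚ + ε) - x
    left-gap = solve-∀ ℚ-ring

    right-gap : ∀ x ε → (0ℚ + ε) - - x ≡ (x + ε) - 0ℚ
    right-gap = solve-∀ ℚ-ring

    left-sum : ∀ x y δ → ((x + δ) + (y + δ)) - (0ℚ + 0ℚ) ≡ (x + y) + (δ + δ) - 0ℚ
    left-sum = solve-∀ ℚ-ring

    right-sum : ∀ x y δ → ((0ℚ + δ) + (0ℚ + δ)) - (x + y) ≡ 0ℚ + (δ + δ) - (x + y)
    right-sum = solve-∀ ℚ-ring

    cramer₁ : ∀ x y a b c d → a * (x * d - y * c) - c * (x * b - y * a) ≡ (a * d - b * c) * x
    cramer₁ = solve-∀ ℚ-ring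

    cramer₂ : ∀ x y a b c d → b * (x * d - y * c) - d * (x * b - y * a) ≡ (a * d - b * c) * y
    cramer₂ = solve-∀ ℚ-ring

  -- Lattice points on a real line

  -- As (t x)(s y) = (t y)(s x), the determinant is a combination of the four residuals with bounded
  -- coefficients. It is therefore null, and being constant it is zero.
  On-collinear : ∀ ℒ {p q} → ι p ∈ On ℒ → ι q ∈ On ℒ → detℤ p q ≡ 0ℤ
  On-collinear ℒ {a , b} {c , d} (t , ta , tb) (s , sc , sd) = ⟦⟧≡0 (null-const (null-resp
    (λ n → trans (det-residuals ⟦ a ⟧ ⟦ b ⟧ ⟦ c ⟧ ⟦ d ⟧ (seq t n) (seq s n) (seq d₁ n) (seq d₂ n)) (sym (⟦det⟧ a b c d)))
    (null-+ (null-- (null-*ℚ ⟦ d ⟧ ta) (null-*ℚ ⟦ c ⟧ tb))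
            (null-- (null-* (t *ᴿ d₁) sd) (null-* (t *ᴿ d₂) sc)))))
    where
    d₁ = proj₁ (direction ℒ)
    d₂ = proj₂ (direction ℒ)

  O≢⇒nonNull : ∀ ℒ {p} → p ≢ O → ((t , _) : ι p ∈ On ℒ) → ¬ Null (seq t)
  O≢⇒nonNull ℒ {a , b} p≢O (t , ta , tb) null =
    p≢O (cong₂ _,_ (vanish a (proj₁ (direction ℒ)) ta) (vanish b (proj₂ (direction ℒ)) tb))
    where
    vanish : ∀ a x → fromℤ a ≈ᴿ t *ᴿ x → a ≡ 0ℤ
    vanish a x ta = ⟦⟧≡0 (null-const (null-resp (λ n → subtract-add ⟦ a ⟧ (seq t n) (seq x n)) (null-+ ta (null-* x null))))

  On-sided : ExcludedMiddle 0ℓ → ∀ ℒ {p} → p ≢ O → ι p ∈ On ℒ → ι p ∈ OnPositiveSide ℒ ⊎ ι p ∈ OnNegativeSide ℒ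
  On-sided em ℒ p≢O (t , on) =
    Sum.map (λ 0<t → t , 0<t , on) (λ t<0 → t , t<0 , on) (sign-of-nonzero em t (O≢⇒nonNull ℒ p≢O (t , on)))

  -- Eliminating the direction shows that s |p|² - t (p · q) tends to zero. If p · q were
  -- nonnegative, then t > 0 and s < - δ would keep this quantity at most - δ.
  opposite-sides-dot : ∀ ℒ {p q} → p ≢ O → ι p ∈ OnPositiveSide ℒ → ι q ∈ OnNegativeSide ℒ → dotℤ p q ℤ.< 0ℤ
  opposite-sides-dot ℒ {a , b} {c , d} p≢O (t , (ε , 0<ε , t>ε) , ta , tb) (s , (δ , 0<δ , s<-δ) , sc , sd) =
    ℤ.≰⇒> λ 0≤D → eventually-const (eventually₂ (contra 0≤D) (eventually₂ (λ _ → _,_) t>ε s<-δ) (null δ 0<δ))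
    where
    p = a , b
    d₁ = proj₁ (direction ℒ)
    d₂ = proj₂ (direction ℒ)
    N = ⟦ dotℤ p p ⟧
    D = ⟦ dotℤ p (c , d) ⟧
    null : Null (λ n → seq s n * N - seq t n * D)
    null = null-resp (λ n → trans (exchange-dot ⟦ a ⟧ ⟦ b ⟧ ⟦ c ⟧ ⟦ d ⟧ (seq t n) (seq s n) (seq d₁ n) (seq d₂ n))
        (sym (cong₂ (λ z w → seq s n * z - seq t n * w) (⟦dot⟧ a b a b) (⟦dot⟧ a b c d))))
      (null-+ (null-*ℚ ⟦ a ⟧ (null-- (null-* s ta) (null-* t sc)))
              (null-*ℚ ⟦ b ⟧ (null-- (null-* s tb) (null-* t sd))))
    -- By integrality, the margin δ survives multiplication by |p|².
    1≤N : 1ℚ ≤ N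
    1≤N = ⟦⟧-≤ (ℤ.i<j⇒suc[i]≤j (norm-pos p≢O))
    contra : 0ℤ ℤ.≤ dotℤ p (c , d) → ∀ n → (0ℚ + ε < seq t n) × (seq s n + δ < 0ℚ) →
      ∣ seq s n * N - seq t n * D ∣ < δ → ⊥
    contra 0≤D n (tn , sn) close = ℚ.<-irrefl refl (begin-strict
        δ                            ≡⟨ ℚ.*-identityʳ δ ⟨
        δ * 1ℚ                       ≤⟨ ℚ.*-monoˡ-≤-nonNeg δ {{ℚ.pos⇒nonNeg δ {{ℚ.positive 0<δ}}}} 1≤N ⟩
        δ * N                        ≤⟨ ℚ.*-monoʳ-≤-nonNeg N {{ℚ.nonNegative 0≤N}} (ℚ.<⇒≤ δ<-s) ⟩
        - S * N                      ≡⟨ ℚ.+-identityʳ (- S * N) ⟨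
        - S * N + 0ℚ                 ≤⟨ ℚ.+-monoʳ-≤ (- S * N) 0≤TD ⟩
        - S * N + T * D              ≡⟨ neg-difference S N T D ⟩
        - (S * N - T * D)            <⟨ ∣∣<-lower close ⟩
        δ                            ∎)
      where
      open ℚ.≤-Reasoning
      S = seq s n
      T = seq t n
      δ<-s : δ < - S
      δ<-s = <-shift δ (- S) (flip-sum S δ) sn
      0≤N : 0ℚ ≤ N
      0≤N = ℚ.≤-trans (ℚ.<⇒≤ (ℚ.positive⁻¹ 1ℚ)) 1≤N
      0≤T : 0ℚ ≤ T
      0≤T = ℚ.<⇒≤ (ℚ.<-trans 0<ε (ℚ.<-respˡ-≡ (ℚ.+-identityˡ ε) tn))
      0≤TD : 0ℚ ≤ T * D
      0≤TD = ℚ.≤-trans (ℚ.≤-reflexive (sym (ℚ.*-zeroʳ T))) (ℚ.*-monoˡ-≤-nonNeg T {{ℚ.nonNegative 0≤T}} (⟦⟧-≤ 0≤D))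

  -- Dividing `dot-parallel` by |p|² gives the factor k = (p · q) / |p|².
  ratio : ∀ {p q} → p ≢ O → detℤ p q ≡ 0ℤ → ∃[ k ]
    ((⟦ proj₁ q ⟧ ≡ k * ⟦ proj₁ p ⟧ × ⟦ proj₂ q ⟧ ≡ k * ⟦ proj₂ p ⟧) × (dotℤ p q ℤ.< 0ℤ → k < 0ℚ))
  ratio {p@(a , b)} {q@(c , d)} p≢O e = N⁻¹ * D ,
    (scale c a (cong proj₁ parallel) , scale d b (cong proj₂ parallel)) ,
    λ D<0 → ℚ.<-respʳ-≡ (ℚ.*-zeroʳ N⁻¹) (ℚ.*-monoʳ-<-pos N⁻¹ {{ℚ.positive 0<N⁻¹}} (⟦⟧-< D<0))
    where
    N = ⟦ dotℤ p p ⟧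
    D = ⟦ dotℤ p q ⟧
    inv = recip (⟦⟧-< (norm-pos p≢O))
    N⁻¹ = proj₁ inv
    0<N⁻¹ = proj₁ (proj₂ inv)
    parallel = dot-parallel p q e
    scale : ∀ c a → dotℤ p p ℤ.* c ≡ dotℤ p q ℤ.* a → ⟦ c ⟧ ≡ N⁻¹ * D * ⟦ a ⟧
    scale c a e = begin
      ⟦ c ⟧                  ≡⟨ ℚ.*-identityˡ ⟦ c ⟧ ⟨
      1ℚ * ⟦ c ⟧             ≡⟨ cong (_* ⟦ c ⟧) (proj₂ (proj₂ inv)) ⟨
      N * N⁻¹ * ⟦ c ⟧        ≡⟨ swap-factor N N⁻¹ ⟦ c ⟧ ⟩
      N⁻¹ * (N * ⟦ c ⟧)      ≡⟨ cong (N⁻¹ *_) (⟦⟧-* (dotℤ p p) c) ⟨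
      N⁻¹ * ⟦ dotℤ p p ℤ.* c ⟧  ≡⟨ cong (λ z → N⁻¹ * ⟦ z ⟧) e ⟩
      N⁻¹ * ⟦ dotℤ p q ℤ.* a ⟧  ≡⟨ cong (N⁻¹ *_) (⟦⟧-* (dotℤ p q) a) ⟩
      N⁻¹ * (D * ⟦ a ⟧)      ≡⟨ ℚ.*-assoc N⁻¹ D ⟦ a ⟧ ⟨
      N⁻¹ * D * ⟦ a ⟧        ∎
      where
      open ≡-Reasoning

  module _ (ℒ : Line) {p q : ℤ²} (p≢O : p ≢ O) (collinear : detℤ p q ≡ 0ℤ) (opposite : dotℤ p q ℤ.< 0ℤ) where
    private
      k = proj₁ (ratio p≢O collinear)
      q≡kp = proj₁ (proj₂ (ratio p≢O collinear))
      k<0 = proj₂ (proj₂ (ratio p≢O collinear)) opposite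

      0<-kε : ∀ {ε} → 0ℚ < ε → 0ℚ < - (k * ε)
      0<-kε {ε} 0<ε = ℚ.neg-antimono-< (ℚ.<-respʳ-≡ (ℚ.*-zeroʳ k) (ℚ.*-monoʳ-<-neg k {{ℚ.negative k<0}} 0<ε))

      scaled : ∀ t → ι p ≈² t · direction ℒ → ι q ≈² (fromℚ k *ᴿ t) · direction ℒ
      scaled t (ta , tb) = coord (proj₁ p) (proj₁ q) (proj₁ (direction ℒ)) (proj₁ q≡kp) ta ,
        coord (proj₂ p) (proj₂ q) (proj₂ (direction ℒ)) (proj₂ q≡kp) tb
        where
        coord : ∀ a c x → ⟦ c ⟧ ≡ k * ⟦ a ⟧ → fromℤ a ≈ᴿ t *ᴿ x → fromℤ c ≈ᴿ fromℚ k *ᴿ t *ᴿ x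
        coord a c x e ta = null-resp
          (λ n → trans (scale-residual k ⟦ a ⟧ (seq t n) (seq x n)) (cong (λ z → z - k * seq t n * seq x n) (sym e)))
          (null-*ℚ k ta)

    -- Since q = k p with k < 0, the parameter k t serves for q, and the margin ε becomes - k ε.
    positive⇒negative : ι p ∈ OnPositiveSide ℒ → ι q ∈ OnNegativeSide ℒ
    positive⇒negative (t , (ε , 0<ε , ev) , tp) = fromℚ k *ᴿ t ,
      (- (k * ε) , 0<-kε 0<ε , eventually (λ n h →
        <-shift (k * seq t n + - (k * ε)) 0ℚ (scale-gap⁺ k ε (seq t n)) (ℚ.*-monoʳ-<-neg k {{ℚ.negative k<0}} h)) ev) ,
      scaled t tp

    negative⇒positive : ι p ∈ OnNegativeSide ℒ → ι q ∈ OnPositiveSide ℒ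
    negative⇒positive (t , (ε , 0<ε , ev) , tp) = fromℚ k *ᴿ t ,
      (- (k * ε) , 0<-kε 0<ε , eventually (λ n h →
        <-shift (0ℚ + - (k * ε)) (k * seq t n) (scale-gap⁻ k ε (seq t n)) (ℚ.*-monoʳ-<-neg k {{ℚ.negative k<0}} h)) ev) ,
      scaled t tp

  lineThrough : ∀ p → p ≢ O → Line
  lineThrough p p≢O = record { direction = ι p ; nonzero = λ (na , nb) →
    p≢O (cong₂ _,_ (vanish (proj₁ p) na) (vanish (proj₂ p) nb)) }
    where
    vanish : ∀ a → fromℤ a ≈ᴿ 0ᴿ → a ≡ 0ℤ
    vanish a na = ⟦⟧≡0 (null-const (null-resp (λ _ → subtract-zero ⟦ a ⟧) na))

  collinear⇒On : ∀ p (p≢O : p ≢ O) {q} → detℤ p q ≡ 0ℤ → ι q ∈ On (lineThrough p p≢O)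
  collinear⇒On p p≢O {q} e = fromℚ k ,
    coord (proj₁ p) (proj₁ q) (proj₁ (proj₁ (proj₂ r))) ,
    coord (proj₂ p) (proj₂ q) (proj₂ (proj₁ (proj₂ r)))
    where
    r = ratio p≢O e
    k = proj₁ r
    coord : ∀ a c → ⟦ c ⟧ ≡ k * ⟦ a ⟧ → fromℤ c ≈ᴿ fromℚ k *ᴿ fromℤ a
    coord a c e = null-0 λ n → trans (cong (_- (k * ⟦ a ⟧)) e) (ℚ.+-inverseʳ (k * ⟦ a ⟧))

  -- Half-planes

  ⟦det⟧-seq : ∀ p q n → ⟦ detℤ p q ⟧ ≡ seq (det (ι p) (ι q)) n
  ⟦det⟧-seq (a , b) (c , d) n = ⟦det⟧ a b c d

  det≤0⇒Right : ∀ p (p≢O : p ≢ O) {q} → detℤ p q ℤ.≤ 0ℤ → ι q ∈ RightHalfPlane (lineThrough p p≢O)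
  det≤0⇒Right p p≢O {q} le ε 0<ε = 0 , λ n _ → ℚ.≤-<-trans
    (ℚ.≤-trans (ℚ.≤-reflexive (sym (⟦det⟧-seq p q n))) (⟦⟧-≤ le))
    (ℚ.<-respʳ-≡ (sym (ℚ.+-identityˡ ε)) 0<ε)

  0≤det⇒Left : ∀ p (p≢O : p ≢ O) {q} → 0ℤ ℤ.≤ detℤ p q → ι q ∈ LeftHalfPlane (lineThrough p p≢O)
  0≤det⇒Left p p≢O {q} le ε 0<ε = 0 , λ n _ → ℚ.<-respˡ-≡ (ℚ.+-identityˡ 0ℚ)
    (ℚ.+-mono-≤-< (ℚ.≤-trans (⟦⟧-≤ le) (ℚ.≤-reflexive (⟦det⟧-seq p q n))) 0<ε)

  module _ (ℒ : Line) where
    private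
      d₁ d₂ : ℝ
      d₁ = proj₁ (direction ℒ)
      d₂ = proj₂ (direction ℒ)
      D : ℤ² → ℕ → ℚ
      D p = seq (det (direction ℒ) (ι p))

      D-⊕ : ∀ p q n → D (p ⊕ q) n ≡ D p n + D q n
      D-⊕ (a , b) (c , d) n = trans
        (cong₂ (λ z w → seq d₁ n * z - seq d₂ n * w) (⟦⟧-+ b d) (⟦⟧-+ a c))
        (det-sum (seq d₁ n) (seq d₂ n) ⟦ a ⟧ ⟦ b ⟧ ⟦ c ⟧ ⟦ d ⟧)

      D-⊖ : ∀ p n → D (⊖ p) n ≡ - D p n
      D-⊖ (a , b) n = trans
        (cong₂ (λ z w → seq d₁ n * z - seq d₂ n * w) (⟦⟧-neg b) (⟦⟧-neg a))
        (det-neg (seq d₁ n) (seq d₂ n) ⟦ a ⟧ ⟦ b ⟧)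

      D-O : ∀ n → D O n ≡ 0ℚ
      D-O n = det-zero (seq d₁ n) (seq d₂ n)

    Left∩Right : ∀ {p} → ι p ∈ LeftHalfPlane ℒ → ι p ∈ RightHalfPlane ℒ → Null (D p)
    Left∩Right {p} l r ε 0<ε = eventually₂ (λ n hl hr →
        ∣∣<-intro (ℚ.<-respʳ-≡ (ℚ.+-identityˡ ε) hr) (<-shift (- D p n) ε (reflect-gap (D p n) ε) hl))
      (l ε 0<ε) (r ε 0<ε)

    ⊖-Left : ∀ {p} → ι (⊖ p) ∈ LeftHalfPlane ℒ → ι p ∈ RightHalfPlane ℒ
    ⊖-Left {p} l ε 0<ε = eventually (λ n h →
        <-shift (D p n) (0ℚ + ε) (left-gap (D p n) ε) (subst (λ z → 0ℚ < z + ε) (D-⊖ p n) h)) (l ε 0<ε)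

    ⊖-Right : ∀ {p} → ι (⊖ p) ∈ RightHalfPlane ℒ → ι p ∈ LeftHalfPlane ℒ
    ⊖-Right {p} r ε 0<ε = eventually (λ n h →
        <-shift 0ℚ (D p n + ε) (right-gap (D p n) ε) (subst (_< 0ℚ + ε) (D-⊖ p n) h)) (r ε 0<ε)

    module _ {X : Pred ℤ² 0ℓ} where

      ⟨⟩⊆Left : X ⊆ (ι ⊢ LeftHalfPlane ℒ) → ⟨ X ⟩ ⊆ (ι ⊢ LeftHalfPlane ℒ)
      ⟨⟩⊆Left h (gen p∈) = h p∈
      ⟨⟩⊆Left h zero ε 0<ε = 0 , λ n _ → ℚ.<-respʳ-≡ (sym (trans (cong (_+ ε) (D-O n)) (ℚ.+-identityˡ ε))) 0<ε
      ⟨⟩⊆Left h (add {p} {q} p∈ q∈) ε 0<ε = eventually₂ (λ n hp hq →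
          <-shift 0ℚ (D (p ⊕ q) n + ε)
            (trans (left-sum (D p n) (D q n) δ) (cong₂ (λ z w → z + w - 0ℚ) (sym (D-⊕ p q n)) (sym (proj₂ (proj₂ (halve 0<ε))))))
            (ℚ.+-mono-< hp hq))
        (⟨⟩⊆Left h p∈ δ 0<δ) (⟨⟩⊆Left h q∈ δ 0<δ)
        where
        δ = proj₁ (halve 0<ε)
        0<δ = proj₁ (proj₂ (halve 0<ε))

      ⟨⟩⊆Right : X ⊆ (ι ⊢ RightHalfPlane ℒ) → ⟨ X ⟩ ⊆ (ι ⊢ RightHalfPlane ℒ)
      ⟨⟩⊆Right h (gen p∈) = h p∈
      ⟨⟩⊆Right h zero ε 0<ε = 0 , λ n _ → subst₂ _<_ (sym (D-O n)) (sym (ℚ.+-identityˡ ε)) 0<ε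
      ⟨⟩⊆Right h (add {p} {q} p∈ q∈) ε 0<ε = eventually₂ (λ n hp hq →
          <-shift (D (p ⊕ q) n) (0ℚ + ε)
            (trans (right-sum (D p n) (D q n) δ) (cong₂ (λ z w → 0ℚ + w - z) (sym (D-⊕ p q n)) (sym (proj₂ (proj₂ (halve 0<ε))))))
            (ℚ.+-mono-< hp hq))
        (⟨⟩⊆Right h p∈ δ 0<δ) (⟨⟩⊆Right h q∈ δ 0<δ)
        where
        δ = proj₁ (halve 0<ε)
        0<δ = proj₁ (proj₂ (halve 0<ε))

      -- A closed half-plane is closed under addition, so it contains both p and - p. The latter
      -- puts p in the opposite half-plane too, and the two half-planes meet in the bounding line.
      group-in-half-plane : (∀ {p} → p ∈ ⟨ X ⟩ → (⊖ p) ∈ ⟨ X ⟩) →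
        X ⊆ (ι ⊢ LeftHalfPlane ℒ) ⊎ X ⊆ (ι ⊢ RightHalfPlane ℒ) → ∀ {p} → p ∈ ⟨ X ⟩ → Null (D p)
      group-in-half-plane neg (inj₁ h) {p} p∈ = Left∩Right {p} (⟨⟩⊆Left h p∈) (⊖-Left {p} (⟨⟩⊆Left h (neg p∈)))
      group-in-half-plane neg (inj₂ h) {p} p∈ = Left∩Right {p} (⊖-Right {p} (⟨⟩⊆Right h (neg p∈))) (⟨⟩⊆Right h p∈)

    -- The two hypotheses are linear equations for the direction of ℒ with determinant `detℤ p q`.
    -- Were it nonzero, Cramer's rule would make the direction zero.
    null-det⇒collinear : ∀ {p q} → Null (D p) → Null (D q) → detℤ p q ≡ 0ℤ
    null-det⇒collinear {p@(a , b)} {q@(c , d)} np nq =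
      decidable-stable (detℤ p q ℤ.≟ 0ℤ) λ e → nonzero ℒ (coord e d₁ n₁ , coord e d₂ n₂)
      where
      n₁ : Null (λ n → ⟦ detℤ p q ⟧ * seq d₁ n)
      n₁ = null-resp (λ n → trans (cramer₁ (seq d₁ n) (seq d₂ n) ⟦ a ⟧ ⟦ b ⟧ ⟦ c ⟧ ⟦ d ⟧)
          (cong (_* seq d₁ n) (sym (⟦det⟧ a b c d))))
        (null-- (null-*ℚ ⟦ a ⟧ nq) (null-*ℚ ⟦ c ⟧ np))
      n₂ : Null (λ n → ⟦ detℤ p q ⟧ * seq d₂ n)
      n₂ = null-resp (λ n → trans (cramer₂ (seq d₁ n) (seq d₂ n) ⟦ a ⟧ ⟦ b ⟧ ⟦ c ⟧ ⟦ d ⟧)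
          (cong (_* seq d₂ n) (sym (⟦det⟧ a b c d))))
        (null-- (null-*ℚ ⟦ b ⟧ nq) (null-*ℚ ⟦ d ⟧ np))
      coord : detℤ p q ≢ 0ℤ → ∀ x → Null (λ n → ⟦ detℤ p q ⟧ * seq x n) → x ≈ᴿ 0ᴿ
      coord e x nx = null-resp (λ n → sym (ℚ.+-identityʳ (seq x n)))
        (null-cancel-*ℚ (λ z → e (⟦⟧≡0 z)) nx)

  -- Suprema of rational lower sets

  archimedean : ∀ q → ∃[ n ] q < ⟦ + n ⟧
  -- The denominator is at least 1, so the absolute value of the numerator is an upper bound; the
  -- successor makes it strict.
  archimedean q@(mkℚ i d _) = suc ℤ.∣ i ∣ , ℚ.≤-<-trans
    (subst (q ≤_) (sym (⟦⟧-fromℤ (+ ℤ.∣ i ∣))) (ℚ.*≤* (ℤ.≤-trans (ℤ.≤-reflexive (ℤ.*-identityʳ i)) (bound i d))))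
    (⟦⟧-< (ℤ.+<+ (ℕ.n<1+n ℤ.∣ i ∣)))
    where
    bound : ∀ i d → i ℤ.≤ + ℤ.∣ i ∣ ℤ.* +[1+ d ]
    bound (+ n)    d = ℤ.≤-trans (ℤ.+≤+ (ℕ.m≤m*n n (suc d))) (ℤ.≤-reflexive (ℤ.pos-* n (suc d)))
    bound -[1+ n ] d = ℤ.-≤+

  0<⟦suc⟧ : ∀ n → 0ℚ < ⟦ + suc n ⟧
  0<⟦suc⟧ n = ⟦⟧-< {0ℤ} {+ suc n} (ℤ.+<+ (ℕ.s≤s ℕ.z≤n))

  -- mesh n = 1 / (n + 1)
  mesh : ℕ → ℚ
  mesh n = proj₁ (recip (0<⟦suc⟧ n))

  0<mesh : ∀ n → 0ℚ < mesh n
  0<mesh n = proj₁ (proj₂ (recip (0<⟦suc⟧ n)))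

  suc*mesh : ∀ n → ⟦ + suc n ⟧ * mesh n ≡ 1ℚ
  suc*mesh n = proj₂ (proj₂ (recip (0<⟦suc⟧ n)))

  mesh-vanishes : ∀ ε → 0ℚ < ε → Eventually λ n → mesh n < ε
  mesh-vanishes ε 0<ε = N , λ n N≤n → begin-strict
      mesh n                          ≡⟨ ℚ.*-identityʳ (mesh n) ⟨
      mesh n * 1ℚ                     <⟨ ℚ.*-monoʳ-<-pos (mesh n) {{ℚ.positive (0<mesh n)}} (1<sε n N≤n) ⟩
      mesh n * (⟦ + suc n ⟧ * ε)      ≡⟨ lem (mesh n) ⟦ + suc n ⟧ ε ⟩
      (⟦ + suc n ⟧ * mesh n) * ε      ≡⟨ cong (_* ε) (suc*mesh n) ⟩
      1ℚ * ε                          ≡⟨ ℚ.*-identityˡ ε ⟩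
      ε                               ∎
    where
    open ℚ.≤-Reasoning
    inv = recip 0<ε
    ε⁻¹ = proj₁ inv
    N = proj₁ (archimedean ε⁻¹)
    lem : ∀ m s ε → m * (s * ε) ≡ (s * m) * ε
    lem = solve-∀ ℚ-ring
    1<sε : ∀ n → N ℕ.≤ n → 1ℚ < ⟦ + suc n ⟧ * ε
    1<sε n N≤n = begin-strict
      1ℚ                 ≡⟨ proj₂ (proj₂ inv) ⟨
      ε * ε⁻¹            ≡⟨ ℚ.*-comm ε ε⁻¹ ⟩
      ε⁻¹ * ε            <⟨ ℚ.*-monoˡ-<-pos ε {{ℚ.positive 0<ε}} (ℚ.<-≤-trans (proj₂ (archimedean ε⁻¹))
                              (⟦⟧-≤ (ℤ.+≤+ (ℕ.≤-trans N≤n (ℕ.n≤1+n n))))) ⟩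
      ⟦ + suc n ⟧ * ε    ∎

  module _ (em : ExcludedMiddle 0ℓ) (L : Pred ℚ 0ℓ) (L-down : ∀ {p q} → p ≤ q → L q → L p)
           {lo hi : ℚ} (L-lo : L lo) (¬L-hi : ¬ L hi) where
    private
      -- A walk by steps of δ that starts inside `L` and is outside after K steps must leave `L` at
      -- one of them.
      last-step : ∀ δ K x → L x → ¬ L (x + ⟦ + K ⟧ * δ) → ∃[ y ] (L y × ¬ L (y + δ))
      last-step δ zero    x Lx ¬L = ⊥-elim (¬L (subst L (sym (lem x δ)) Lx))
        where
        lem : ∀ x δ → x + 0ℚ * δ ≡ x
        lem = solve-∀ ℚ-ring
      last-step δ (suc K) x Lx ¬L with em {L (x + δ)}
      ... | no  ¬Lxδ = x , Lx , ¬Lxδ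
      ... | yes Lxδ  = last-step δ K (x + δ) Lxδ λ LK → ¬L (subst L (sym eq) LK)
        where
        lem : ∀ x k δ → x + (1ℚ + k) * δ ≡ (x + δ) + k * δ
        lem = solve-∀ ℚ-ring
        eq : x + ⟦ + suc K ⟧ * δ ≡ (x + δ) + ⟦ + K ⟧ * δ
        eq = trans (cong (λ z → x + z * δ) (⟦⟧-+ 1ℤ (+ K))) (lem x ⟦ + K ⟧ δ)

      approximation : ∀ n → ∃[ y ] (L y × ¬ L (y + mesh n))
      approximation n = last-step (mesh n) K lo L-lo λ LK → ¬L-hi (L-down hi≤ LK)
        where
        open ℚ.≤-Reasoning
        -- More than (hi - lo)(n + 1) steps of length 1 / (n + 1) lead from lo past hi.
        bound = archimedean ((hi - lo) * ⟦ + suc n ⟧)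
        K = proj₁ bound
        lem₁ : ∀ lo hi → hi ≡ lo + (hi - lo) * 1ℚ
        lem₁ = solve-∀ ℚ-ring
        hi≤ : hi ≤ lo + ⟦ + K ⟧ * mesh n
        hi≤ = begin
          hi                                            ≡⟨ lem₁ lo hi ⟩
          lo + (hi - lo) * 1ℚ                           ≡⟨ cong (λ z → lo + (hi - lo) * z) (suc*mesh n) ⟨
          lo + (hi - lo) * (⟦ + suc n ⟧ * mesh n)       ≡⟨ cong (λ z → lo + z) (ℚ.*-assoc (hi - lo) ⟦ + suc n ⟧ (mesh n)) ⟨
          lo + (hi - lo) * ⟦ + suc n ⟧ * mesh n         ≤⟨ ℚ.+-monoʳ-≤ lo (ℚ.<⇒≤ (ℚ.*-monoˡ-<-pos (mesh n) {{ℚ.positive (0<mesh n)}} (proj₂ bound))) ⟩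
          lo + ⟦ + K ⟧ * mesh n                         ∎

    -- Since u m lies in `L` and u n + mesh n does not, u m - u n < mesh n, which makes the sequence
    -- Cauchy. The bounds are kept for each term, because the later estimates are made term by term.
    supremum : ∃[ r ] (∀ n → L (seq r n) × ¬ L (seq r n + mesh n))
    supremum = record { seq = u ; isCauchy = cauchy } , λ n → proj₂ (approximation n)
      where
      u : ℕ → ℚ
      u n = proj₁ (approximation n)
      lem₁ : ∀ a b δ → (b + δ) - a ≡ δ - (a - b)
      lem₁ = solve-∀ ℚ-ring
      lem₂ : ∀ a b → b - a ≡ - (a - b)
      lem₂ = solve-∀ ℚ-ring
      gap : ∀ m n → u m - u n < mesh n
      gap m n = <-shift (u m - u n) (mesh n) (lem₁ (u m) (u n) (mesh n))
        (ℚ.≰⇒> λ le → proj₂ (proj₂ (approximation n)) (L-down le (proj₁ (proj₂ (approximation m)))))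
      cauchy : Cauchy u
      cauchy ε 0<ε = proj₁ (mesh-vanishes ε 0<ε) , λ m n N≤m N≤n → ∣∣<-intro
        (ℚ.<-trans (gap m n) (proj₂ (mesh-vanishes ε 0<ε) n N≤n))
        (ℚ.<-respˡ-≡ (lem₂ (u m) (u n)) (ℚ.<-trans (gap n m) (proj₂ (mesh-vanishes ε 0<ε) m N≤m)))

  -- Separation by a half-plane

  private
    -- For x = (a , b), y = (c , d), z = (e , f): the pairs (x · y , det x y) and (x · z , det x z)
    -- are coordinates in the frame of x and its quarter turn, scaled by |x|², and their determinant
    -- is |x|² det y z.
    cross-dot : ∀ a b c d e f → (a ℤ.* c ℤ.+ b ℤ.* d) ℤ.* (ℤ.- (a ℤ.* f ℤ.- b ℤ.* e)) ℤ.- (ℤ.- (a ℤ.* e ℤ.+ b ℤ.* f)) ℤ.* (a ℤ.* d ℤ.- b ℤ.* c)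
      ≡ (a ℤ.* a ℤ.+ b ℤ.* b) ℤ.* (ℤ.- (c ℤ.* f ℤ.- d ℤ.* e))
    cross-dot = ℤ-Solver.solve-∀

    add-one : ∀ a y z → (a * z + 1ℚ) * y ≡ a * (y * z) + y
    add-one = solve-∀ ℚ-ring

    swap-right : ∀ q y d → q * y * d ≡ q * d * y
    swap-right = solve-∀ ℚ-ring

    pivot-det : ∀ r a b c d → (r * a - b) * d - (r * b + a) * c ≡ r * (a * d - b * c) - (a * c + b * d)
    pivot-det = solve-∀ ℚ-ring

    pivot-norm : ∀ r a b → a * (r * b + a - 0ℚ) - b * (r * a - b - 0ℚ) ≡ a * a + b * b
    pivot-norm = solve-∀ ℚ-ring

    right-slack : ∀ q m E F → (q + m) * - E - - F ≡ m * - E - (q * E - F)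
    right-slack = solve-∀ ℚ-ring

    flat-slack : ∀ q F → q * 0ℚ - F ≡ - F
    flat-slack = solve-∀ ℚ-ring

  -- By `reflex`, turning from a left step y to a right step z through - x takes at least a half
  -- turn, and `forward` excludes steps opposite to x. This leaves room for a bounding line.
  module _ (em : ExcludedMiddle 0ℓ) {X : Pred ℤ² 0ℓ} (x : ℤ²) (x≢O : x ≢ O)
    (reflex : ∀ {y z} → y ∈ X → z ∈ X → 0ℤ ℤ.< detℤ x y → detℤ x z ℤ.< 0ℤ → detℤ y z ℤ.≤ 0ℤ)
    (forward : ∀ {w} → w ∈ X → detℤ x w ≡ 0ℤ → 0ℤ ℤ.≤ dotℤ x w) where

    private
      -- For y left of x, dot x y / det x y is the cotangent of the angle from x to y.
      BelowCotangents : Pred ℚ 0ℓ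
      BelowCotangents q = ∀ {y} → y ∈ X → 0ℤ ℤ.< detℤ x y → q * ⟦ detℤ x y ⟧ ≤ ⟦ dotℤ x y ⟧

      down : ∀ {p q} → p ≤ q → BelowCotangents q → BelowCotangents p
      down {p} {q} p≤q below {y} y∈ 0<Y = ℚ.≤-trans
        (ℚ.*-monoʳ-≤-nonNeg ⟦ detℤ x y ⟧ {{ℚ.nonNegative (⟦⟧-≤ (ℤ.<⇒≤ 0<Y))}} p≤q) (below y∈ 0<Y)

      -- By `cross-dot` the difference of the two sides is - |x|² det y z. Divided by the positive
      -- numbers det x y and - det x z, it compares the cotangents of z and y.
      cotangents-ordered : ∀ {y z} → y ∈ X → z ∈ X → 0ℤ ℤ.< detℤ x y → detℤ x z ℤ.< 0ℤ →
        (ℤ.- dotℤ x z) ℤ.* detℤ x y ℤ.≤ dotℤ x y ℤ.* (ℤ.- detℤ x z)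
      cotangents-ordered {y} {z} y∈ z∈ 0<Y Z<0 = ℤ.0≤i-j⇒j≤i (ℤ.≤-trans nonneg (ℤ.≤-reflexive (sym
        (cross-dot (proj₁ x) (proj₂ x) (proj₁ y) (proj₂ y) (proj₁ z) (proj₂ z)))))
        where
        N = dotℤ x x
        nonneg : 0ℤ ℤ.≤ N ℤ.* (ℤ.- detℤ y z)
        nonneg = 0≤m*n (ℤ.<⇒≤ (norm-pos x≢O)) (ℤ.neg-mono-≤ (reflex y∈ z∈ 0<Y Z<0))

      -- Transitivity through the cotangent of z. Contrapositively, a number outside
      -- `BelowCotangents` exceeds the cotangent of every right step.
      below-right : ∀ q {z} → z ∈ X → detℤ x z ℤ.< 0ℤ → q * ⟦ ℤ.- detℤ x z ⟧ ≤ ⟦ ℤ.- dotℤ x z ⟧ → BelowCotangents q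
      below-right q {z} z∈ Z<0 h {y} y∈ 0<Y = ℚ.*-cancelʳ-≤-pos D {{ℚ.positive 0<D}} (begin
        q * Y * D      ≡⟨ swap-right q Y D ⟩
        q * D * Y      ≤⟨ ℚ.*-monoʳ-≤-nonNeg Y {{ℚ.nonNegative (⟦⟧-≤ (ℤ.<⇒≤ 0<Y))}} h ⟩
        B * Y          ≡⟨ ⟦⟧-* (ℤ.- dotℤ x z) (detℤ x y) ⟨
        ⟦ (ℤ.- dotℤ x z) ℤ.* detℤ x y ⟧   ≤⟨ ⟦⟧-≤ (cotangents-ordered y∈ z∈ 0<Y Z<0) ⟩
        ⟦ dotℤ x y ℤ.* (ℤ.- detℤ x z) ⟧   ≡⟨ ⟦⟧-* (dotℤ x y) (ℤ.- detℤ x z) ⟩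
        ⟦ dotℤ x y ⟧ * D  ∎)
        where
        open ℚ.≤-Reasoning
        Y = ⟦ detℤ x y ⟧
        D = ⟦ ℤ.- detℤ x z ⟧
        B = ⟦ ℤ.- dotℤ x z ⟧
        0<D : 0ℚ < D
        0<D = ⟦⟧-< (ℤ.neg-mono-< Z<0)

      -- For a left step, u n lies below its cotangent; for a step along x, `forward` applies. For a
      -- right step, only u n + mesh n is known to exceed the cotangent, which costs an error mesh n
      -- (- det x w) that tends to zero.
      right-of-pivot : ∀ (u : ℕ → ℚ) → (∀ n → BelowCotangents (u n) × ¬ BelowCotangents (u n + mesh n)) →
        ∀ {w} → w ∈ X → ∀ ε → 0ℚ < ε → Eventually λ n → u n * ⟦ detℤ x w ⟧ - ⟦ dotℤ x w ⟧ < ε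
      right-of-pivot u bounds {w} w∈ ε 0<ε with ℤ.<-cmp 0ℤ (detℤ x w)
      ... | tri< 0<W _ _ = 0 , λ n _ → ℚ.≤-<-trans
            (ℚ.≤-trans (ℚ.+-monoˡ-≤ (- ⟦ dotℤ x w ⟧) (proj₁ (bounds n) w∈ 0<W))
              (ℚ.≤-reflexive (ℚ.+-inverseʳ ⟦ dotℤ x w ⟧))) 0<ε
      ... | tri≈ _ 0≡W _ = 0 , λ n _ → ℚ.≤-<-trans
            (ℚ.≤-trans (ℚ.≤-reflexive (trans (cong (λ z → u n * ⟦ z ⟧ - ⟦ dotℤ x w ⟧) (sym 0≡W)) (flat-slack (u n) ⟦ dotℤ x w ⟧)))
              (ℚ.neg-antimono-≤ (⟦⟧-≤ (forward w∈ (sym 0≡W))))) 0<ε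
      ... | tri> _ _ W<0 = eventually (λ n m<δ → ℚ.<-trans (slack n) (m*D<ε n m<δ)) (mesh-vanishes (ε * D⁻¹) (0<p*q 0<ε 0<D⁻¹))
        where
        D = ⟦ ℤ.- detℤ x w ⟧
        0<D : 0ℚ < D
        0<D = ⟦⟧-< (ℤ.neg-mono-< W<0)
        D⁻¹ = proj₁ (recip 0<D)
        0<D⁻¹ = proj₁ (proj₂ (recip 0<D))
        slack : ∀ n → u n * ⟦ detℤ x w ⟧ - ⟦ dotℤ x w ⟧ < mesh n * D
        slack n = <-shift {⟦ ℤ.- dotℤ x w ⟧} {(u n + mesh n) * D} (u n * ⟦ detℤ x w ⟧ - ⟦ dotℤ x w ⟧) (mesh n * D)
          (trans (cong₂ (λ d f → (u n + mesh n) * d - f) (⟦⟧-neg (detℤ x w)) (⟦⟧-neg (dotℤ x w)))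
            (trans (right-slack (u n) (mesh n) ⟦ detℤ x w ⟧ ⟦ dotℤ x w ⟧)
              (cong (λ d → mesh n * d - (u n * ⟦ detℤ x w ⟧ - ⟦ dotℤ x w ⟧)) (sym (⟦⟧-neg (detℤ x w))))))
          (ℚ.≰⇒> λ le → proj₂ (bounds n) (below-right (u n + mesh n) w∈ W<0 le))
        m*D<ε : ∀ n → mesh n < ε * D⁻¹ → mesh n * D < ε
        m*D<ε n h = ℚ.<-respʳ-≡ eq (ℚ.*-monoˡ-<-pos D {{ℚ.positive 0<D}} h)
          where
          eq : ε * D⁻¹ * D ≡ ε
          eq = trans (ℚ.*-assoc ε D⁻¹ D) (trans (cong (ε *_) (trans (ℚ.*-comm D⁻¹ D) (proj₂ (proj₂ (recip 0<D))))) (ℚ.*-identityʳ ε))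

      low : ∀ {z} → z ∈ X → detℤ x z ℤ.< 0ℤ → ∃[ lo ] BelowCotangents lo
      -- The cotangent of z itself.
      low {z} z∈ Z<0 = B * D⁻¹ , below-right (B * D⁻¹) z∈ Z<0 (ℚ.≤-reflexive
        (trans (ℚ.*-assoc B D⁻¹ D) (trans (cong (B *_) (trans (ℚ.*-comm D⁻¹ D) (proj₂ (proj₂ inv)))) (ℚ.*-identityʳ B))))
        where
        D = ⟦ ℤ.- detℤ x z ⟧
        B = ⟦ ℤ.- dotℤ x z ⟧
        inv = recip (⟦⟧-< (ℤ.neg-mono-< Z<0))
        D⁻¹ = proj₁ inv

      high : ∀ {y} → y ∈ X → 0ℤ ℤ.< detℤ x y → ∃[ hi ] ¬ BelowCotangents hi
      -- One more than the cotangent of y.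
      high {y} y∈ 0<Y = A * Y⁻¹ + 1ℚ , λ below → ℚ.<-irrefl refl (ℚ.<-≤-trans A<hiY (below y∈ 0<Y))
        where
        Y = ⟦ detℤ x y ⟧
        A = ⟦ dotℤ x y ⟧
        inv = recip (⟦⟧-< 0<Y)
        Y⁻¹ = proj₁ inv
        eq : A + Y ≡ (A * Y⁻¹ + 1ℚ) * Y
        eq = sym (trans (add-one A Y Y⁻¹) (cong (_+ Y) (trans (cong (A *_) (proj₂ (proj₂ inv))) (ℚ.*-identityʳ A))))
        A<hiY : A < (A * Y⁻¹ + 1ℚ) * Y
        A<hiY = ℚ.<-respʳ-≡ eq (ℚ.<-respˡ-≡ (ℚ.+-identityʳ A) (ℚ.+-monoʳ-< A (⟦⟧-< 0<Y)))

    -- The direction is r x + x⊥ with x⊥ the quarter turn of x, so that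
    -- det (direction) w = r (det x w) - dot x w.
    pivot : ℝ → Line
    pivot r = record
      { direction = r *ᴿ fromℤ a -ᴿ fromℤ b , r *ᴿ fromℤ b +ᴿ fromℤ a
      ; nonzero   = λ (n₁ , n₂) → ℤ.<-irrefl (sym (⟦⟧≡0 (trans (⟦dot⟧ a b a b) (null-const (null-resp
          (λ n → pivot-norm (seq r n) ⟦ a ⟧ ⟦ b ⟧) (null-- (null-*ℚ ⟦ a ⟧ n₂) (null-*ℚ ⟦ b ⟧ n₁))))))) (norm-pos x≢O)
      }
      where
      a = proj₁ x
      b = proj₂ x

    -- The pivot at the supremum of `BelowCotangents` bounds the half-plane. The right step z makes
    -- this set inhabited and the left step y bounds it above.
    reflex⇒WLC : ∀ {y z} → y ∈ X → 0ℤ ℤ.< detℤ x y → z ∈ X → detℤ x z ℤ.< 0ℤ → WLC X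
    reflex⇒WLC y∈ 0<Y z∈ Z<0 = pivot (proj₁ sup) , inj₂ λ {w} w∈ ε 0<ε →
      eventually (λ n → subst₂ _<_ (det-eq w n) (sym (ℚ.+-identityˡ ε))) (right-of-pivot (seq (proj₁ sup)) (proj₂ sup) w∈ ε 0<ε)
      where
      sup = supremum em BelowCotangents down {proj₁ (low z∈ Z<0)} {proj₁ (high y∈ 0<Y)} (proj₂ (low z∈ Z<0)) (proj₂ (high y∈ 0<Y))
      det-eq : ∀ w n → seq (proj₁ sup) n * ⟦ detℤ x w ⟧ - ⟦ dotℤ x w ⟧ ≡ seq (det (direction (pivot (proj₁ sup))) (ι w)) n
      det-eq (c , d) n = sym (trans
        (pivot-det (seq (proj₁ sup) n) ⟦ proj₁ x ⟧ ⟦ proj₂ x ⟧ ⟦ c ⟧ ⟦ d ⟧)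
        (sym (cong₂ (λ e f → seq (proj₁ sup) n * e - f) (⟦det⟧ (proj₁ x) (proj₂ x) c d) (⟦dot⟧ (proj₁ x) (proj₂ x) c d))))

-- Negatives from integer relations with positive coefficients.

module _ where
  open import Data.Integer.Base using (_+_; _*_; _-_; -_; _≤_; _<_)
  open ℤ-Solver using (solve-∀)
  open Algebra.Properties.AbelianGroup ℤ-group using (∙-cancelˡ)

  -- Pairing |p|² q = (p · q) p with x gives |p|² (q · x) = (p · q)(p · x), whose right side is
  -- negative.
  dot-sign : ∀ {p q x} → p ≢ O → detℤ p q ≡ 0ℤ → dotℤ p q < 0ℤ → 0ℤ < dotℤ p x → dotℤ q x < 0ℤ
  dot-sign {p} {q} {x} p≢O e pq<0 0<px = ℤ.≰⇒> λ 0≤qx → ℤ.<-irrefl refl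
    (ℤ.<-≤-trans (0<m*n (ℤ.neg-mono-< pq<0) 0<px) (ℤ.≤-trans (ℤ.≤-reflexive eq) (ℤ.neg-mono-≤ (0≤m*n (ℤ.<⇒≤ (norm-pos p≢O)) 0≤qx))))
    where
    eq : - dotℤ p q * dotℤ p x ≡ - (dotℤ p p * dotℤ q x)
    eq = trans (sym (ℤ.neg-distribˡ-* (dotℤ p q) (dotℤ p x)))
      (cong -_ (trans (sym (dot-⊛ˡ (dotℤ p q) p x)) (trans (cong (λ v → dotℤ v x) (sym (dot-parallel p q e))) (dot-⊛ˡ (dotℤ p p) q x))))

  opposite-member : ∀ {X p q} → p ≢ O → detℤ p q ≡ 0ℤ → dotℤ p q < 0ℤ → p ∈ ⟨ X ⟩ → q ∈ ⟨ X ⟩ → (⊖ q) ∈ ⟨ X ⟩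
  opposite-member {X} {p} {q} p≢O e pq<0 p∈ q∈ = neg-member (norm-pos p≢O)
    (trans (cong (_⊕ (- dotℤ p q) ⊛ p) (dot-parallel p q e)) (cong₂ _,_ (lem (dotℤ p q) (proj₁ p)) (lem (dotℤ p q) (proj₂ p))))
    q∈ (⊛-closed⁺ (ℤ.<⇒≤ (ℤ.neg-mono-< pq<0)) p∈)
    where
    lem : ∀ d a → d * a + - d * a ≡ 0ℤ
    lem = solve-∀

  -- The sign conditions make all three coefficients in `cramer` positive; geometrically, the origin
  -- lies inside the triangle x y z.
  triangle-member : ∀ {X x y z} → 0ℤ < detℤ x y → detℤ x z < 0ℤ → 0ℤ < detℤ y z →
    x ∈ ⟨ X ⟩ → y ∈ ⟨ X ⟩ → z ∈ ⟨ X ⟩ → (⊖ x) ∈ ⟨ X ⟩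
  triangle-member {X} {x} {y} {z} 0<xy xz<0 0<yz x∈ y∈ z∈ = neg-member 0<yz (cramer x y z) x∈
    (add (⊛-closed⁺ (ℤ.<⇒≤ 0<zx) y∈) (⊛-closed⁺ (ℤ.<⇒≤ 0<xy) z∈))
    where
    0<zx : 0ℤ < detℤ z x
    0<zx = subst (0ℤ <_) (sym (det-antisym x z)) (ℤ.neg-mono-< xz<0)

  empty⇒trivial : ∀ {X} → Empty X → IsATrivialGroup (𝒜 X)
  empty⇒trivial {X} empty = isAGroup⁺ (neg-closed λ {p} p∈ → ⊥-elim (empty p p∈)) ,
    λ (p , p∈) → cong proj₁ (trivial p∈) , cong proj₂ (trivial p∈)
    where
    trivial : ∀ {p} → p ∈ ⟨ X ⟩ → p ≡ O
    trivial (gen {p} p∈)  = ⊥-elim (empty p p∈)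
    trivial zero          = refl
    trivial (add p∈ q∈)   = cong₂ _⊕_ (trivial p∈) (trivial q∈)

  -- Collinear step sets

  module _ (em : ExcludedMiddle 0ℓ) {X : Pred ℤ² 0ℓ} (O∉X : O ∉ X) where

    ∈⇒≢O : ∀ {p} → p ∈ X → p ≢ O
    ∈⇒≢O p∈ p≡O = O∉X (subst X p≡O p∈)

    -- Otherwise the functional `dotℤ p` would be nonnegative on ⟨ X ⟩, yet its value at - p is -
    -- |p|².
    group⇒opposite : (∀ {p} → p ∈ ⟨ X ⟩ → (⊖ p) ∈ ⟨ X ⟩) → ∀ {p} → p ∈ X → ∃[ q ] (q ∈ X × dotℤ p q < 0ℤ)
    group⇒opposite neg {p} p∈ = decidable-stable em λ none →
      ℤ.<-irrefl refl (ℤ.≤-<-trans (dot-nonneg p (λ {q} q∈ → ℤ.≮⇒≥ λ lt → none (q , q∈ , lt)) (neg (gen p∈)))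
        (subst (_< 0ℤ) (sym (dot-⊖ p p)) (ℤ.neg-mono-< (norm-pos (∈⇒≢O p∈)))))

    -- Each step x on the line is opposite to p or to q, according to the sign of p · x.
    opposite⇒group : ∀ {p q} → p ∈ X → q ∈ X → (∀ {x y} → x ∈ X → y ∈ X → detℤ x y ≡ 0ℤ) → dotℤ p q < 0ℤ →
      ∀ {x} → x ∈ X → (⊖ x) ∈ ⟨ X ⟩
    opposite⇒group {p} {q} p∈ q∈ collinear pq<0 {x} x∈ = case ℤ.<-cmp (dotℤ p x) 0ℤ of λ where
      (tri< px<0 _ _) → opposite-member (∈⇒≢O p∈) (collinear p∈ x∈) px<0 (gen p∈) (gen x∈)
      (tri≈ _ px≡0 _) → ⊥-elim (∈⇒≢O x∈ (det-dot-unique (∈⇒≢O p∈) (collinear p∈ x∈) (det-O p) (trans px≡0 (sym (dot-O p)))))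
      (tri> _ _ 0<px) → opposite-member (∈⇒≢O q∈) (collinear q∈ x∈)
        (dot-sign {p} {q} {x} (∈⇒≢O p∈) (collinear p∈ q∈) pq<0 0<px) (gen q∈) (gen x∈)

    -- By `det-dot-unique`, `dotℤ p` is injective on 𝒜 X. Its values form a subgroup of ℤ generated
    -- by c = p · u, so every element is m u for a unique m.
    collinear-≅ℤ : ∀ {p} → p ∈ X → (∀ {q} → q ∈ X → detℤ p q ≡ 0ℤ) →
      (g : IsAGroup (𝒜 X)) → toGroup (𝒜 X) g ≅ AbelianGroup.group ℤ-group
    collinear-≅ℤ {p} p∈ collinear g = ≅-fromInverse (toGroup (𝒜 X) g) (AbelianGroup.group ℤ-group)
      h (λ { refl → refl , refl }) (λ m n → ℤ.*-distribʳ-+ (proj₁ u) m n , ℤ.*-distribʳ-+ (proj₂ u) m n)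
      (λ {m} {n} e → *-cancel c≢0 (trans (sym (dot-h m)) (trans (cong (dotℤ p) (cong₂ _,_ (proj₁ e) (proj₂ e))) (dot-h n))))
      (λ (a , a∈) → proj₁ (multiple (a , a∈ , refl)))
      (λ (a , a∈) → let m = multiple (a , a∈ , refl)
                        eq = det-dot-unique (∈⇒≢O p∈) (flat (⊛-closed neg (proj₁ m) u∈)) (flat a∈) (trans (dot-h (proj₁ m)) (sym (proj₂ m)))
                    in cong proj₁ eq , cong proj₂ eq)
      where
      neg = isAGroup⁻ g
      flat = det-vanishes p collinear
      Values : Pred ℤ 0ℓ
      Values k = ∃[ q ] (q ∈ ⟨ X ⟩ × dotℤ p q ≡ k)
      cyclic = subgroup-cyclic em Values
        (λ (q , q∈ , e) (r , r∈ , e′) → q ⊕ r , add q∈ r∈ , trans (dot-⊕ p q r) (cong₂ _+_ e e′))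
        (λ (q , q∈ , e) → ⊖ q , neg q∈ , trans (dot-⊖ p q) (cong -_ e))
        (dotℤ p p) (λ e → ℤ.<-irrefl (sym e) (norm-pos (∈⇒≢O p∈))) (p , gen p∈ , refl)
      c = proj₁ cyclic
      c≢0 = proj₁ (proj₂ cyclic)
      u = proj₁ (proj₁ (proj₂ (proj₂ cyclic)))
      u∈ = proj₁ (proj₂ (proj₁ (proj₂ (proj₂ cyclic))))
      pu≡c = proj₂ (proj₂ (proj₁ (proj₂ (proj₂ cyclic))))
      multiple : ∀ {k} → Values k → ∃[ m ] k ≡ m * c
      multiple = proj₂ (proj₂ (proj₂ cyclic))
      h : ℤ → Σ ℤ² ⟨ X ⟩
      h m = m ⊛ u , ⊛-closed neg m u∈
      dot-h : ∀ m → dotℤ p (m ⊛ u) ≡ m * c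
      dot-h m = trans (dot-⊛ p m u) (cong (m *_) pu≡c)

    line⇔ : Satisfiable X → ∀ ℒ → X ⊆ᴸ ℒ → IsAGroup (𝒜 X) ⇔ BothSides X ℒ
    line⇔ (p , p∈) ℒ X⊆ℒ = mk⇔ to from
      where
      collinear : ∀ {q r} → q ∈ X → r ∈ X → detℤ q r ≡ 0ℤ
      collinear {q} {r} q∈ r∈ = On-collinear ℒ {q} {r} (X⊆ℒ q∈) (X⊆ℒ r∈)
      to : IsAGroup (𝒜 X) → BothSides X ℒ
      -- Once the side of p is known, q lies on the other side as a negative multiple of p.
      to g = case On-sided em ℒ (∈⇒≢O p∈) (X⊆ℒ p∈) of λ where
          (inj₁ pos) → (p , p∈ , pos) , (q , q∈ , positive⇒negative ℒ (∈⇒≢O p∈) (collinear p∈ q∈) pq<0 pos)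
          (inj₂ neg) → (q , q∈ , negative⇒positive ℒ (∈⇒≢O p∈) (collinear p∈ q∈) pq<0 neg) , (p , p∈ , neg)
        where
        opp = group⇒opposite (isAGroup⁻ g) p∈
        q = proj₁ opp
        q∈ = proj₁ (proj₂ opp)
        pq<0 = proj₂ (proj₂ opp)
      from : BothSides X ℒ → IsAGroup (𝒜 X)
      from ((q , q∈ , pos) , (r , r∈ , neg)) = isAGroup⁺ (neg-closed
        (opposite⇒group q∈ r∈ collinear (opposite-sides-dot ℒ (∈⇒≢O q∈) pos neg)))

    -- Planar step sets

    independent-pair : ¬ (∃ λ ℒ → X ⊆ᴸ ℒ) → ∃[ p ] ∃[ q ] (p ∈ X × q ∈ X × detℤ p q ≢ 0ℤ)
    independent-pair noLine = p , proj₁ second , p∈ , proj₂ second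
      where
      first : Satisfiable X
      first = decidable-stable em λ empty →
        -- An empty step set lies on every line; the horizontal axis is an arbitrary choice.
        noLine (lineThrough (1ℤ , 0ℤ) (λ ()) , λ {q} q∈ → ⊥-elim (empty (q , q∈)))
      p = proj₁ first
      p∈ = proj₂ first
      second : ∃[ q ] (q ∈ X × detℤ p q ≢ 0ℤ)
      second = decidable-stable em λ none → noLine (lineThrough p (∈⇒≢O p∈) ,
        λ {q} q∈ → collinear⇒On p (∈⇒≢O p∈) (decidable-stable (detℤ p q ℤ.≟ 0ℤ) λ ne → none (q , q∈ , ne)))

    ¬WLC⇒neg : ¬ WLC X → ∀ {x} → x ∈ X → (⊖ x) ∈ ⟨ X ⟩
    ¬WLC⇒neg ¬wlc {x} x∈ = case em {∃[ w ] (w ∈ X × detℤ x w ≡ 0ℤ × dotℤ x w < 0ℤ)} of λ where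
        (yes (w , w∈ , e , xw<0)) → opposite-member (∈⇒≢O w∈)
          (trans (det-antisym x w) (cong -_ e)) (subst (_< 0ℤ) (sym (dot-comm x w)) xw<0) (gen w∈) (gen x∈)
        (no noOpposite) → case em {∃[ y ] ∃[ z ] (y ∈ X × z ∈ X × 0ℤ < detℤ x y × detℤ x z < 0ℤ × 0ℤ < detℤ y z)} of λ where
          (yes (y , z , y∈ , z∈ , 0<xy , xz<0 , 0<yz)) → triangle-member 0<xy xz<0 0<yz (gen x∈) (gen y∈) (gen z∈)
          (no noTriangle) → ⊥-elim (¬wlc (reflex⇒WLC em x x≢O
            (λ {y} {z} y∈ z∈ 0<xy xz<0 → ℤ.≮⇒≥ λ 0<yz → noTriangle (y , z , y∈ , z∈ , 0<xy , xz<0 , 0<yz))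
            (λ {w} w∈ e → ℤ.≮⇒≥ λ xw<0 → noOpposite (w , w∈ , e , xw<0))
            (proj₁ (proj₂ left)) (proj₂ (proj₂ left)) (proj₁ (proj₂ right)) (proj₂ (proj₂ right))))
      where
      x≢O = ∈⇒≢O x∈
      -- With no step on one side of x, the line through x would itself witness `WLC X`.
      left : ∃[ y ] (y ∈ X × 0ℤ < detℤ x y)
      left = decidable-stable em λ none → ¬wlc (lineThrough x x≢O ,
        inj₂ λ {q} q∈ → det≤0⇒Right x x≢O {q} (ℤ.≮⇒≥ λ lt → none (q , q∈ , lt)))
      right : ∃[ z ] (z ∈ X × detℤ x z < 0ℤ)
      right = decidable-stable em λ none → ¬wlc (lineThrough x x≢O ,
        inj₁ λ {q} q∈ → 0≤det⇒Left x x≢O {q} (ℤ.≮⇒≥ λ lt → none (q , q∈ , lt)))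

    plane⇔ : ¬ (∃ λ ℒ → X ⊆ᴸ ℒ) → IsAGroup (𝒜 X) ⇔ (¬ WLC X)
    plane⇔ noLine = mk⇔
      (λ g (ℒ , half) → let (p , q , p∈ , q∈ , pq≢0) = independent-pair noLine
                            null = group-in-half-plane ℒ (isAGroup⁻ g) half
                        in pq≢0 (null-det⇒collinear ℒ {p} {q} (null (gen p∈)) (null (gen q∈))))
      (λ ¬wlc → isAGroup⁺ (neg-closed (¬WLC⇒neg ¬wlc)))

    -- The isomorphism is given by a Hermite basis (c , d), (0 , e) of 𝒜 X.
    independent-≅ℤ² : ∀ {p q} → p ∈ ⟨ X ⟩ → q ∈ ⟨ X ⟩ → detℤ p q ≢ 0ℤ →
      (g : IsAGroup (𝒜 X)) → toGroup (𝒜 X) g ≅ AbelianGroup.group ℤ²-group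
    independent-≅ℤ² {p} {q} p∈ q∈ pq≢0 g = ≅-fromInverse (toGroup (𝒜 X) g) (AbelianGroup.group ℤ²-group)
      h (λ { (refl , refl) → refl , refl })
      (λ (m , n) (m′ , n′) → homo m n m′ n′ c 0ℤ , homo m n m′ n′ d e)
      inj (λ (a , a∈) → coords a a∈) hf
      where
      neg = isAGroup⁻ g
      First Second : Pred ℤ 0ℓ
      First  k = ∃[ b ] (k , b) ∈ ⟨ X ⟩
      Second k = (0ℤ , k) ∈ ⟨ X ⟩
      nonzeroFirst : ∃[ a ] (a ≢ 0ℤ × First a)
      nonzeroFirst = case proj₁ p ℤ.≟ 0ℤ of λ where
          (no p₁≢0)  → proj₁ p , p₁≢0 , proj₂ p , p∈
          -- If both first coordinates vanished, so would the determinant.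
          (yes p₁≡0) → proj₁ q , (λ q₁≡0 → pq≢0 (trans
            (cong₂ (λ a c → a * proj₂ q - proj₂ p * c) p₁≡0 q₁≡0) (lem (proj₂ q) (proj₂ p)))) , proj₂ q , q∈
        where
        lem : ∀ a b → 0ℤ * a - b * 0ℤ ≡ 0ℤ
        lem = solve-∀
      firstCyclic = subgroup-cyclic em First
        (λ (b , u) (b′ , v) → b + b′ , add u v) (λ (b , u) → - b , neg u)
        (proj₁ nonzeroFirst) (proj₁ (proj₂ nonzeroFirst)) (proj₂ (proj₂ nonzeroFirst))
      c = proj₁ firstCyclic
      c≢0 = proj₁ (proj₂ firstCyclic)
      d = proj₁ (proj₁ (proj₂ (proj₂ firstCyclic)))
      u∈ : (c , d) ∈ ⟨ X ⟩
      u∈ = proj₂ (proj₁ (proj₂ (proj₂ firstCyclic)))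
      -- The combination p₁ q - q₁ p shows that the kernel of the first coordinate is nontrivial.
      eliminate : (0ℤ , detℤ p q) ∈ ⟨ X ⟩
      eliminate = subst ⟨ X ⟩ (cong₂ _,_ (lem₁ (proj₁ p) (proj₁ q)) (lem₂ (proj₁ p) (proj₂ p) (proj₁ q) (proj₂ q)))
        (add (⊛-closed neg (proj₁ p) q∈) (neg (⊛-closed neg (proj₁ q) p∈)))
        where
        lem₁ : ∀ a c → a * c + - (c * a) ≡ 0ℤ
        lem₁ = solve-∀
        lem₂ : ∀ a b c d → a * d + - (c * b) ≡ a * d - b * c
        lem₂ = solve-∀
      secondCyclic = subgroup-cyclic em Second add neg (detℤ p q) pq≢0 eliminate
      e = proj₁ secondCyclic
      e≢0 = proj₁ (proj₂ secondCyclic)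
      v∈ : (0ℤ , e) ∈ ⟨ X ⟩
      v∈ = proj₁ (proj₂ (proj₂ secondCyclic))
      h : ℤ² → Σ ℤ² ⟨ X ⟩
      h (m , n) = m ⊛ (c , d) ⊕ n ⊛ (0ℤ , e) , add (⊛-closed neg m u∈) (⊛-closed neg n v∈)
      homo : ∀ m n m′ n′ c e → (m + m′) * c + (n + n′) * e ≡ (m * c + n * e) + (m′ * c + n′ * e)
      homo = solve-∀
      absorb : ∀ m c n → m * c + n * 0ℤ ≡ m * c
      absorb = solve-∀
      inj : ∀ {x y} → proj₁ (proj₁ (h x)) ≡ proj₁ (proj₁ (h y)) × proj₂ (proj₁ (h x)) ≡ proj₂ (proj₁ (h y)) →
        proj₁ x ≡ proj₁ y × proj₂ x ≡ proj₂ y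
      -- The basis is triangular: first coordinates give m = m′, and then second coordinates give n
      -- = n′.
      inj {m , n} {m′ , n′} eq = m≡m′ , n≡n′
        where
        m≡m′ : m ≡ m′
        m≡m′ = *-cancel c≢0 (trans (sym (absorb m c n)) (trans (proj₁ eq) (absorb m′ c n′)))
        n≡n′ : n ≡ n′
        n≡n′ = *-cancel e≢0 (∙-cancelˡ (m * d) _ _ (trans (proj₂ eq) (cong (λ z → z * d + n′ * e) (sym m≡m′))))
      firstCoord : ∀ a → a ∈ ⟨ X ⟩ → ∃[ m ] proj₁ a ≡ m * c
      firstCoord a a∈ = proj₂ (proj₂ (proj₂ firstCyclic)) (proj₂ a , a∈)
      -- Subtracting m (c , d) clears the first coordinate, so the remainder is a multiple of (0 ,
      -- e).
      residue : ∀ a (a∈ : a ∈ ⟨ X ⟩) → let m = proj₁ (firstCoord a a∈) in (0ℤ , proj₂ a - m * d) ∈ ⟨ X ⟩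
      residue a a∈ = subst ⟨ X ⟩
        (cong₂ _,_ (trans (cong (_+ - (m * c)) (proj₂ (firstCoord a a∈))) (ℤ.+-inverseʳ (m * c))) refl)
        (add a∈ (neg (⊛-closed neg m u∈)))
        where
        m = proj₁ (firstCoord a a∈)
      secondCoord : ∀ a (a∈ : a ∈ ⟨ X ⟩) → ∃[ n ] proj₂ a - proj₁ (firstCoord a a∈) * d ≡ n * e
      secondCoord a a∈ = proj₂ (proj₂ (proj₂ secondCyclic)) (residue a a∈)
      coords : ∀ a → a ∈ ⟨ X ⟩ → ℤ²
      coords a a∈ = proj₁ (firstCoord a a∈) , proj₁ (secondCoord a a∈)
      hf : ∀ a → proj₁ (proj₁ (h (coords (proj₁ a) (proj₂ a)))) ≡ proj₁ (proj₁ a) × proj₂ (proj₁ (h (coords (proj₁ a) (proj₂ a)))) ≡ proj₂ (proj₁ a)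
      hf (a , a∈) = trans (absorb m c n) (sym (proj₂ (firstCoord a a∈))) ,
        trans (cong (_+_ (m * d)) (sym (proj₂ (secondCoord a a∈)))) (lem (m * d) (proj₂ a))
        where
        m = proj₁ (firstCoord a a∈)
        n = proj₁ (secondCoord a a∈)
        lem : ∀ x y → x + (y - x) ≡ y
        lem = solve-∀

theorem2p31 : ExcludedMiddle 0ℓ →
    (X : Pred ℤ² 0ℓ) → O ∉ X →
    (Empty X → IsATrivialGroup (𝒜 X))
    ×
    (Satisfiable X → (ℒ : Line) → X ⊆ᴸ ℒ →
    (IsAGroup (𝒜 X) ⇔ BothSides X ℒ)
    × ((g : IsAGroup (𝒜 X)) → toGroup (𝒜 X) g ≅ AbelianGroup.group ℤ-group))
    ×
    (¬ (∃ λ ℒ → X ⊆ᴸ ℒ) →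
    (IsAGroup (𝒜 X) ⇔ (¬ WLC X))
    × ((g : IsAGroup (𝒜 X)) → toGroup (𝒜 X) g ≅ AbelianGroup.group ℤ²-group))
theorem2p31 em X O∉X =
  empty⇒trivial ,
  (λ (p , p∈) ℒ X⊆ℒ → line⇔ em O∉X (p , p∈) ℒ X⊆ℒ ,
    collinear-≅ℤ em O∉X p∈ (λ {q} q∈ → On-collinear ℒ {p} {q} (X⊆ℒ p∈) (X⊆ℒ q∈))) ,
  (λ noLine → let (p , q , p∈ , q∈ , pq≢0) = independent-pair em O∉X noLine
              in plane⇔ em O∉X noLine , independent-≅ℤ² em O∉X (gen p∈) (gen q∈) pq≢0)
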